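{- Let $\mathbf K$ be a fragmented AEC with the amalgamation property and with no models of cardinality $< \mathrm{LS}(\mathbf K)$. Assume that for every $\lambda \in \mathrm{dom}(\mathbf K)$, $\mathbf K$ is categorical in $\lambda$ and stable in $\lambda$. Then every $M \in \mathbf K$ with $\|M\| > \mathrm{LS}(\mathbf K)$ is model-homogeneous.
   Context: An abstract class $\mathbf K=(K,\le_{\mathbf K})$ is a class of structures in a fixed vocabulary $\tau(\mathbf K)$, closed under isomorphism, with a partial order extending substructure and invariant under isomorphism. $\mathrm{LS}(\mathbf K)$ is the least $\lambda\ge|\tau(\mathbf K)|+\aleph_0$ such that every $A\subseteq|M|$, $M\in\mathbf K$, is contained in some $M_0\le_{\mathbf K} M$ with $\|M_0\|\le|A|+\lambda$. A fragmented AEC is an abstract class with $\mathrm{LS}(\mathbf K)<\infty$ satisfying: coherence (if $|M_0|\subseteq|M_1|$, $M_0\le_{\mathbf K}M_2$, $M_1\le_{\mathbf K}M_2$ then $M_0\le_{\mathbf K}M_1$); restricted chain axiom (if $\langle M_i:i<\delta\rangle$ is increasing, $M_\delta=\bigcup_i M_i$, and $\|M_i\|=\|M_\delta\|$ for some $i<\delta$, then $M_\delta\in\mathbf K$ and $M_0\le_{\mathbf K}M_\delta$); smoothness (if $\langle M_i:i<\delta\rangle$ is increasing and $N\in\mathbf K$ with $M_i\le_{\mathbf K}N$ for all $i$, then $\bigcup_i M_i\in\mathbf K$ and $\bigcup_i M_i\le_{\mathbf K}N$). $\mathrm{dom}(\mathbf K)$ is the class of cardinals $\lambda$ with a model of cardinality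 $\lambda$. Orbital types $\mathrm{S}(M)$ over $M$: classes of triples $(b,M,N)$, $M \le_{\mathbf K} N$, $b\in |N|$, under the transitive closure of "there are $\mathbf K$-embeddings of $N_1,N_2$ into a common model fixing $M$ and sending $b_1,b_2$ to the same element". Stable in $\lambda$: $|\mathrm S(M)|\le\lambda$ for every $M$ of cardinality $\lambda$. Categorical in $\lambda$: exactly one model of cardinality $\lambda$ up to isomorphism. $M$ is model-homogeneous if whenever $M_0\le_{\mathbf K}N_0$, $M_0\le_{\mathbf K}M$ and $\|N_0\|<\|M\|$, there is a $\mathbf K$-embedding $N_0\to M$ fixing $M_0$. -}

module Defs where

open import Level using (Level; _⊔_) renaming (suc to lsuc)
open import Data.Nat.Base using (ℕ)
open import Data.Product using (Σ-syntax; ∃-syntax; _×_)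
open import Data.Sum using (_⊎_)
open import Data.Vec.Base using (Vec; map)
open import Function.Bundles using (_⇔_; _↔_; _↣_; module Injection)
open import Function.Definitions using (Injective; Surjective; Congruent)
open import Induction.WellFounded using (WellFounded)
open import Relation.Binary.Construct.Closure.Transitive using (TransClosure)
open import Relation.Binary.PropositionalEquality using (_≡_)
open import Relation.Binary.Structures using (IsStrictTotalOrder)
open import Relation.Nullary using (¬_)

-- Conventions.  Sets are types in Set ℓ; a class is a predicate on large
-- types.  The cardinality of a set is the type itself, considered up to
-- bijection (_↔_) and compared by injections (_↣_).

_≺_ : ∀ {a b} → Set a → Set b → Set (a ⊔ b)
X ≺ Y = (X ↣ Y) × ¬ (Y ↣ X)

-- The proper class from which the elements of structures are drawn, so that
-- literal inclusion |M| ⊆ |N| and unions of chains make sense.  Its members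
-- serve only as atoms compared by _≡_ (never extensionally, as sets).  The
-- trees are chosen because no small family exhausts them: sup A f is
-- different from every f a, by well-foundedness.

data V (ℓ : Level) : Set (lsuc ℓ) where
  sup : (A : Set ℓ) → (A → V ℓ) → V ℓ

record Vocabulary (ℓ : Level) : Set (lsuc ℓ) where
  field
    Fun      : Set ℓ
    Rel      : Set ℓ
    funArity : Fun → ℕ
    relArity : Rel → ℕ

  Symbol : Set ℓ
  Symbol = Fun ⊎ Rel

-- The universe |M| is the subset of V enumerated without repetition by `el`.
-- Relations are read up to logical equivalence.

record Structure {ℓ} (τ : Vocabulary ℓ) : Set (lsuc ℓ) where
  open Vocabulary τ
  field
    Carrier : Set ℓ
    el      : Carrier → V ℓ
    el-inj  : Injective _≡_ _≡_ el
    fun     : (F : Fun) → Vec Carrier (funArity F) → Carrier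
    rel     : (R : Rel) → Vec Carrier (relArity R) → Set ℓ

open Structure using (el)

∣_∣ : ∀ {ℓ} {τ : Vocabulary ℓ} → Structure τ → Set ℓ
∣_∣ = Structure.Carrier

module _ {ℓ} {τ : Vocabulary ℓ} where
  open Vocabulary τ

  infix 4 _∈_ _⊆_ _⊑_ _≅_

  _∈_ : V ℓ → Structure τ → Set (lsuc ℓ)
  v ∈ M = ∃[ a ] el M a ≡ v

  _⊆_ : Structure τ → Structure τ → Set (lsuc ℓ)
  M ⊆ N = ∀ a → el M a ∈ N

  record IsEmbedding (M N : Structure τ) (f : ∣ M ∣ → ∣ N ∣) : Set ℓ where
    private
      module M = Structure M
      module N = Structure N
    field
      injective : Injective _≡_ _≡_ f
      fun-hom   : ∀ F xs → f (M.fun F xs) ≡ N.fun F (map f xs)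
      rel-iff   : ∀ R xs → M.rel R xs ⇔ N.rel R (map f xs)

  record _⊑_ (M N : Structure τ) : Set (lsuc ℓ) where
    field
      incl        : ∣ M ∣ → ∣ N ∣
      incl-el     : ∀ a → el N (incl a) ≡ el M a
      isEmbedding : IsEmbedding M N incl

  record _≅_ (M N : Structure τ) : Set ℓ where
    field
      to          : ∣ M ∣ → ∣ N ∣
      isEmbedding : IsEmbedding M N to
      surjective  : Surjective _≡_ _≡_ to

-- Antisymmetry of ≤K is not a field: M ≤K N and N ≤K M give M ⊑ N and
-- N ⊑ M, i.e. M and N are the same structure on the same subset of V.  They
-- may still be different terms (el may enumerate that subset differently);
-- ≤K-resp-≅ ensures that this makes no difference.

record AbstractClass {ℓ} (τ : Vocabulary ℓ) (k : Level) :
       Set (lsuc ℓ ⊔ lsuc k) where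
  infix 4 _≤K_
  field
    Model      : Structure τ → Set k
    _≤K_       : Structure τ → Structure τ → Set k
    ≤K-modelˡ  : ∀ {M N} → M ≤K N → Model M
    ≤K-modelʳ  : ∀ {M N} → M ≤K N → Model N
    ≤K⇒⊑       : ∀ {M N} → M ≤K N → M ⊑ N
    ≤K-refl    : ∀ {M} → Model M → M ≤K M
    ≤K-trans   : ∀ {M N P} → M ≤K N → N ≤K P → M ≤K P
    Model-resp-≅ : ∀ {M N} → M ≅ N → Model M → Model N
    -- g : N ≅ N′ carries M onto M′, f being its restriction.
    ≤K-resp-≅  : ∀ {M N M′ N′} (f : M ≅ M′) (g : N ≅ N′) →
                 (∀ a b → el M a ≡ el N b →
                    el M′ (_≅_.to f a) ≡ el N′ (_≅_.to g b)) →
                 M ≤K N → M′ ≤K N′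

-- A nonempty well-order, standing for an ordinal δ > 0.

record WellOrder (ℓ : Level) : Set (lsuc ℓ) where
  infix 4 _<_
  field
    Index              : Set ℓ
    _<_                : Index → Index → Set ℓ
    isStrictTotalOrder : IsStrictTotalOrder _≡_ _<_
    wellFounded        : WellFounded _<_
    0#                 : Index
    0#-least           : ∀ i → ¬ (i < 0#)

module ClassNotions {ℓ k} {τ : Vocabulary ℓ} (K : AbstractClass τ k) where
  open Vocabulary τ
  open AbstractClass K

  record KEmbedding (M N : Structure τ) : Set (lsuc ℓ ⊔ k) where
    field
      image   : Structure τ
      iso     : M ≅ image
      image≤N : image ≤K N

    value : ∣ M ∣ → V ℓ
    value a = el image (_≅_.to iso a)

  open KEmbedding using (value)

  Fixes : ∀ {M N} (M₀ : Structure τ) → KEmbedding M N → Set (lsuc ℓ)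
  Fixes {M} M₀ f = ∀ a x → el M₀ a ≡ el M x → value f x ≡ el M₀ a

  -- A ↣ ∣ M ∣ encodes a subset of |M|, and A ⊎ Λ the cardinal |A| + λ.
  LSBound : Set ℓ → Set (lsuc ℓ ⊔ k)
  LSBound Λ =
    ((Symbol ⊎ ℕ) ↣ Λ) ×
    (∀ M → Model M → (A : Set ℓ) (s : A ↣ ∣ M ∣) →
       ∃[ M₀ ] M₀ ≤K M ×
               (∀ a → el M (Injection.to s a) ∈ M₀) ×
               (∣ M₀ ∣ ↣ (A ⊎ Λ)))

  IsLS : Set ℓ → Set (lsuc ℓ ⊔ k)
  IsLS Λ = LSBound Λ × (∀ Λ′ → LSBound Λ′ → Λ ↣ Λ′)

  Coherence : Set (lsuc ℓ ⊔ k)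
  Coherence = ∀ M₀ M₁ M₂ → M₀ ⊆ M₁ → M₀ ≤K M₂ → M₁ ≤K M₂ → M₀ ≤K M₁

  module _ (δ : WellOrder ℓ) where
    open WellOrder δ

    record Increasing (M : Index → Structure τ) : Set (ℓ ⊔ k) where
      field
        model : ∀ i → Model (M i)
        mono  : ∀ {i j} → i < j → M i ≤K M j

    record IsUnion (M : Index → Structure τ) (U : Structure τ) :
           Set (lsuc ℓ) where
      field
        upper   : ∀ i → M i ⊑ U
        covered : ∀ u → ∃[ i ] el U u ∈ M i

  -- The union of a chain is unique as a structure on a subset of V; in
  -- both chain axioms U ranges over its presentations.

  RestrictedChain : Set (lsuc ℓ ⊔ k)
  RestrictedChain =
    ∀ (δ : WellOrder ℓ) → let open WellOrder δ in
    ∀ M → Increasing δ M → ∀ U → IsUnion δ M U →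
    (∃[ i ] (∣ M i ∣ ↔ ∣ U ∣)) → Model U × M 0# ≤K U

  Smoothness : Set (lsuc ℓ ⊔ k)
  Smoothness =
    ∀ (δ : WellOrder ℓ) M → Increasing δ M →
    ∀ N → Model N → (∀ i → M i ≤K N) →
    ∀ U → IsUnion δ M U → Model U × U ≤K N

  Amalgamation : Set (lsuc ℓ ⊔ k)
  Amalgamation =
    ∀ M₀ M₁ M₂ → M₀ ≤K M₁ → M₀ ≤K M₂ →
    ∃[ N ] Σ[ f₁ ∈ KEmbedding M₁ N ] Σ[ f₂ ∈ KEmbedding M₂ N ]
      Fixes M₀ f₁ × Fixes M₀ f₂

  Dom : Set ℓ → Set (lsuc ℓ ⊔ k)
  Dom Λ = ∃[ M ] Model M × (∣ M ∣ ↔ Λ)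

  Categorical : Set ℓ → Set (lsuc ℓ ⊔ k)
  Categorical Λ =
    Dom Λ ×
    (∀ M N → Model M → Model N → (∣ M ∣ ↔ Λ) → (∣ N ∣ ↔ Λ) → M ≅ N)

  record Triple (M : Structure τ) : Set (lsuc ℓ ⊔ k) where
    field
      N   : Structure τ
      M≤N : M ≤K N
      b   : ∣ N ∣

  AtomicEquiv : ∀ {M} → Triple M → Triple M → Set (lsuc ℓ ⊔ k)
  AtomicEquiv {M} s t =
    ∃[ P ] Σ[ f₁ ∈ KEmbedding S.N P ] Σ[ f₂ ∈ KEmbedding T.N P ]
      Fixes M f₁ × Fixes M f₂ × value f₁ S.b ≡ value f₂ T.b
    where
    module S = Triple s
    module T = Triple t

  SameType : ∀ {M} → Triple M → Triple M → Set (lsuc ℓ ⊔ k)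
  SameType = TransClosure AtomicEquiv

  -- |S(M)| ≤ λ: an injection into Λ from the quotient of the triples by
  -- SameType.
  Stable : Set ℓ → Set (lsuc ℓ ⊔ k)
  Stable Λ =
    ∀ M → Model M → (∣ M ∣ ↔ Λ) →
    Σ[ c ∈ (Triple M → Λ) ] Congruent SameType _≡_ c × Injective SameType _≡_ c

  ModelHomogeneous : Structure τ → Set (lsuc ℓ ⊔ k)
  ModelHomogeneous M =
    ∀ M₀ N₀ → M₀ ≤K N₀ → M₀ ≤K M → ∣ N₀ ∣ ≺ ∣ M ∣ →
    Σ[ f ∈ KEmbedding N₀ M ] Fixes M₀ f

record FragmentedAEC {ℓ} (τ : Vocabulary ℓ) (k : Level) :
       Set (lsuc ℓ ⊔ lsuc k) where
  field
    abstractClass : AbstractClass τ k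

  open AbstractClass abstractClass public
  open ClassNotions abstractClass public

  field
    LS              : Set ℓ
    isLS            : IsLS LS
    coherence       : Coherence
    restrictedChain : RestrictedChain
    smoothness      : Smoothness

{-# OPTIONS --safe #-}
-- Let X be the cardinality of N₀ and Y its successor.  Stability in X lets a model of
-- size Y be extended, within size Y, so as to realize all types over its submodels of
-- size X; the union of a chain of Y such extensions is saturated, by regularity of Y, and
-- every model of size Y is isomorphic to it by categoricity in Y.  The chain axiom is only
-- applied to chains of models of one fixed cardinality, as is allowed in a fragmented AEC.
-- Saturation gives homogeneity by moving N₀ into the saturated model one element at a time.
-- For an arbitrary M, only a submodel of size Y containing M₀ is needed, so that limit
-- cardinals require no separate argument.
--
-- Decidability of arbitrary types acts as a global choice function; the well-ordering
-- theorem and X × X ≃ X for infinite X are derived from it.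
module Submission where

open import Defs
open import Axiom.ExcludedMiddle using (ExcludedMiddle)
open import Axiom.Extensionality.Propositional using (Extensionality; implicit-extensionality)
open import Data.Bool.Base using (Bool; true; false; T)
open import Data.Bool.Properties using (T-irrelevant)
open import Data.Empty using (⊥-elim)
open import Data.Maybe.Base as Maybe using (Maybe; just; nothing; maybe′)
open import Data.Maybe.Properties using (just-injective; map-injective)
open import Data.Nat.Base using (ℕ; _+_; _*_) renaming (suc to 1+_; _<_ to _<ℕ_)
import Data.Nat.Properties as ℕₚ
open import Data.Product using (Σ; Σ-syntax; ∃; ∃-syntax; _×_; _,_; proj₁; proj₂)
open import Data.Product.Function.NonDependent.Propositional using (_×-↣_)
open import Data.Product.Relation.Binary.Lex.Strict
  using (×-Lex; ×-transitive; ×-compare; ×-wellFounded)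
open import Data.Sum using (_⊎_; inj₁; inj₂; [_,_]′)
open import Data.Sum.Function.Propositional using (_⊎-↣_)
open import Data.Unit.Base using (⊤; tt)
open import Data.Vec.Base as Vec using (Vec; []; _∷_)
open import Data.Vec.Properties using (map-id; map-∘; map-cong; ∷-injective)
open import Function.Base using (_∘_; _on_; case_of_; id)
open import Function.Bundles
  using (_⇔_; _↔_; _↣_; mk↣; mk↔ₛ′; module Injection; module Inverse)
open import Function.Definitions using (Injective; Congruent)
import Function.Properties.Equivalence as ⇔
open import Function.Properties.Injection using (↣-refl; ↣-trans)
open import Function.Properties.Inverse using (↔⇒↣; ↔-sym; ↔-refl; ↔-trans)
open import Induction.WellFounded using (WellFounded; Acc; acc; module All; module FixPoint)
open import Level using (Level; _⊔_; Lift; lift; lower) renaming (suc to lsuc)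
open import Relation.Binary.Consequences using (tri⇒irr)
open import Relation.Binary.Construct.Add.Infimum.Strict
  using (_<₋_; [_]; ⊥₋<[_]; <₋-wellFounded; <₋-isStrictTotalOrder-≡)
open import Relation.Binary.Construct.Closure.Transitive using (_∷_) renaming ([_] to [_]⁺)
open import Relation.Binary.Construct.On using () renaming (wellFounded to on-wellFounded)
open import Relation.Binary.Definitions using (Transitive; Trichotomous; tri<; tri≈; tri>)
open import Relation.Binary.PropositionalEquality
  using (_≡_; _≢_; refl; sym; trans; cong; cong₂; subst; isEquivalence; resp₂
        ; module ≡-Reasoning)
open import Relation.Binary.Structures using (IsStrictTotalOrder)
open import Relation.Binary.Structures.Biased using (isStrictTotalOrderᶜ)
open import Relation.Nullary using (¬_; yes; no; contradiction)
open import Relation.Nullary.Decidable using (True; isYes; toWitness; fromWitness)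

-- An orbital type concerns a single element: an element of the target with the right type over a
-- submodel does not by itself extend an embedding of that submodel to a larger model. So each step
-- of moving `N₀` absorbs a whole submodel of the target around the realizing element, and in return
-- the source grows beyond `N₀` inside an amalgam; in the end only the points of `N₀` must have been
-- captured.
--
-- Amalgams come without a size bound. They are cut back to size X or Y by Löwenheim-Skolem hulls,
-- and coherence recovers `≤K` between the pieces; the absence of models below `LS` gives `LS` ≤ X,
-- as these hulls require. A second obstacle is that `M₀` may be smaller than `N₀`, while stability
-- in X speaks of models of size exactly X; both are first enlarged to that size.
--
-- Universes are subsets of `V`, and the axioms speak of literal inclusion. Hence embeddings are
-- repeatedly turned into inclusions by renaming points, which is possible because fresh points of
-- `V` never run out.

private
  variable
    a b c ℓ k r p : Level
    A B C D : Set a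
    τ : Vocabulary ℓ

-- Well-orders and cardinals

_∙_ : A ↣ B → A → B
_∙_ = Injection.to

∙-inj : (f : A ↣ B) → ∀ {x y} → f ∙ x ≡ f ∙ y → x ≡ y
∙-inj = Injection.injective

infixr 9 _∙_

bijective⇒↔ : (f : A → B) → Injective _≡_ _≡_ f → (∀ y → ∃[ x ] f x ≡ y) → A ↔ B
bijective⇒↔ f inj sur =
  mk↔ₛ′ f (proj₁ ∘ sur) (proj₂ ∘ sur) (λ x → inj (proj₂ (sur (f x))))

Maybe-↣ : A ↣ B → Maybe A ↣ Maybe B
Maybe-↣ f = mk↣ {to = Maybe.map (f ∙_)} (map-injective (∙-inj f))

-- s² + a with a ≤ s determines s, being strictly below (s + 1)².
ℕ×ℕ↣ℕ : (ℕ × ℕ) ↣ ℕ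
ℕ×ℕ↣ℕ = mk↣ {to = code} inj
  where
  code : ℕ × ℕ → ℕ
  code (a , b) = (a + b) * (a + b) + a
  gap : ∀ a b a′ b′ → a + b <ℕ a′ + b′ → code (a , b) <ℕ code (a′ , b′)
  gap a b a′ b′ lt = begin-strict
    s * s + a        ≤⟨ ℕₚ.+-monoʳ-≤ (s * s) (ℕₚ.m≤m+n a b) ⟩
    s * s + s        ≡⟨ ℕₚ.+-comm (s * s) s ⟩
    s + s * s        <⟨ ℕₚ.+-monoˡ-< (s * s) (ℕₚ.n<1+n s) ⟩
    1+ s + s * s  ≤⟨ ℕₚ.+-monoʳ-≤ (1+ s) (ℕₚ.*-monoʳ-≤ s (ℕₚ.n≤1+n s)) ⟩
    1+ s * 1+ s ≤⟨ ℕₚ.*-mono-≤ lt lt ⟩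
    s′ * s′          ≤⟨ ℕₚ.m≤m+n (s′ * s′) a′ ⟩
    s′ * s′ + a′     ∎
    where
    open ℕₚ.≤-Reasoning
    s  = a + b
    s′ = a′ + b′
  inj : Injective _≡_ _≡_ code
  inj {a , b} {a′ , b′} e with ℕₚ.<-cmp (a + b) (a′ + b′)
  ... | tri< lt _ _ = contradiction e (ℕₚ.<⇒≢ (gap a b a′ b′ lt))
  ... | tri> _ _ gt = contradiction (sym e) (ℕₚ.<⇒≢ (gap a′ b′ a b gt))
  ... | tri≈ _ s≡ _
    rewrite s≡ with refl ← ℕₚ.+-cancelˡ-≡ _ a a′ e
    = cong (a ,_) (ℕₚ.+-cancelˡ-≡ a b b′ s≡)

record WO {ℓ} (X : Set ℓ) : Set (lsuc ℓ) where
  infix 4 _<_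
  field
    _<_     : X → X → Set ℓ
    <-trans : Transitive _<_
    compare : Trichotomous _≡_ _<_
    wf      : WellFounded _<_

  <-irrefl : ∀ {x} → ¬ (x < x)
  <-irrefl = tri⇒irr compare refl

WO-pullback : {X Y : Set ℓ} → X ↣ Y → WO Y → WO X
WO-pullback {X = X} {Y} f w = record
  { _<_     = _<_ on (f ∙_)
  ; <-trans = <-trans
  ; compare = cmp
  ; wf      = on-wellFounded (f ∙_) wf
  }
  where
  open WO w
  cmp : Trichotomous _≡_ (_<_ on (f ∙_))
  cmp x y with compare (f ∙ x) (f ∙ y)
  ... | tri< l n m = tri< l (n ∘ cong (f ∙_)) m
  ... | tri≈ l e m = tri≈ l (∙-inj f e) m
  ... | tri> l n m = tri> l (n ∘ cong (f ∙_)) m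

WO-× : {X Y : Set ℓ} → WO X → WO Y → WO (X × Y)
WO-× {X = X} {Y} v w = record
  { _<_     = ×-Lex _≡_ v._<_ w._<_
  ; <-trans = ×-transitive {_<₂_ = w._<_} isEquivalence (resp₂ v._<_) v.<-trans w.<-trans
  ; compare = cmp
  ; wf      = ×-wellFounded v.wf w.wf
  }
  where
  module v = WO v
  module w = WO w
  cmp : Trichotomous _≡_ (×-Lex _≡_ v._<_ w._<_)
  cmp x y with ×-compare sym v.compare w.compare x y
  ... | tri< l n m = tri< l (λ { refl → n (refl , refl) }) m
  ... | tri≈ l (refl , refl) m = tri≈ l refl m
  ... | tri> l n m = tri> l (λ { refl → n (refl , refl) }) m

-- Subsets, Cantor-Bernstein and well-founded recursion

module Sets (em : ∀ {a} → ExcludedMiddle a) (ext : ∀ {a b} → Extensionality a b) where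

  -- Proof-irrelevant and in the lowest universe whatever the level of the proposition, so that
  -- subsets stay small and their points are equal as soon as the first components are. `unsquash`
  -- recovers a witness, namely the one stored by `em`: this is the form in which choice is used.
  ∥_∥ : Set a → Set
  ∥ P ∥ = True (em {P = P})

  squash : A → ∥ A ∥
  squash = fromWitness

  unsquash : ∥ A ∥ → A
  unsquash = toWitness

  ¬∀⇒∃¬ : {P : A → Set b} → ¬ (∀ x → P x) → ∃[ x ] ¬ P x
  ¬∀⇒∃¬ {P = P} n with em {P = ∃[ x ] ¬ P x}
  ... | yes e = e
  ... | no ne = ⊥-elim (n λ x → case em of λ where
          (yes p) → p
          (no np) → ⊥-elim (ne (x , np)))

  sub-≡ : {P : A → Set b} {u v : Σ[ x ∈ A ] ∥ P x ∥} → proj₁ u ≡ proj₁ v → u ≡ v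
  sub-≡ {u = x , p} {v = .x , q} refl = cong (x ,_) (T-irrelevant p q)

  sub-↣ : {P : A → Set b} → (Σ[ x ∈ A ] ∥ P x ∥) ↣ A
  sub-↣ = mk↣ sub-≡

  image-↣ : (g : A → B) → (Σ[ y ∈ B ] ∥ ∃[ x ] g x ≡ y ∥) ↣ A
  image-↣ g = mk↣ {to = λ (y , p) → proj₁ (unsquash p)} λ {(y , p)} {(z , q)} e →
    sub-≡ (trans (sym (proj₂ (unsquash p))) (trans (cong g e) (proj₂ (unsquash q))))

  Σ-↣ : {F : A → Set b} → A ↣ C → (∀ x → F x ↣ D) → (Σ A F) ↣ (C × D)
  Σ-↣ {A = A} {C = C} {D = D} {F = F} f g = mk↣ {to = h} inj
    where
    h : Σ A F → C × D
    h (x , y) = f ∙ x , g x ∙ y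
    inj : Injective _≡_ _≡_ h
    inj {x , y} {x′ , y′} e with ∙-inj f (cong proj₁ e)
    ... | refl = cong (x ,_) (∙-inj (g x) (cong proj₂ e))

  module _ {A : Set a} {B : Set b} (f : A ↣ B) (g : B ↣ A) where

    private
      -- The orbits under `g` after `f` of the points outside the range of `g`. The bijection
      -- follows `f` on them and the inverse of `g` elsewhere.
      data Shifted : A → Set (a ⊔ b) where
        start : ∀ {x} → (∀ y → g ∙ y ≢ x) → Shifted x
        shift : ∀ {x} → Shifted x → Shifted (g ∙ f ∙ x)

      unshift : ∀ {x y} → Shifted x → x ≡ g ∙ y → ∃[ z ] Shifted z × f ∙ z ≡ y
      unshift (start n) e = contradiction (sym e) (n _)
      unshift (shift s) e = _ , s , ∙-inj g e

      Swap : A → B → Set (a ⊔ b)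
      Swap x y = (Shifted x × f ∙ x ≡ y) ⊎ (¬ Shifted x × g ∙ y ≡ x)

      swap : ∀ x → ∃[ y ] Swap x y
      swap x with em {P = Shifted x}
      ... | yes s = f ∙ x , inj₁ (s , refl)
      ... | no n with em {P = ∃[ y ] g ∙ y ≡ x}
      ...   | yes (y , e) = y , inj₂ (n , e)
      ...   | no ne = contradiction (start λ y e → ne (y , e)) n

      swap-inj : ∀ {x x′ y} → Swap x y → Swap x′ y → x ≡ x′
      swap-inj (inj₁ (_ , e)) (inj₁ (_ , e′)) = ∙-inj f (trans e (sym e′))
      swap-inj (inj₂ (_ , e)) (inj₂ (_ , e′)) = trans (sym e) e′
      swap-inj (inj₁ (s , e)) (inj₂ (n , e′)) =
        contradiction (subst Shifted (trans (cong (g ∙_) e) e′) (shift s)) n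
      swap-inj (inj₂ (n , e)) (inj₁ (s , e′)) =
        contradiction (subst Shifted (trans (cong (g ∙_) e′) e) (shift s)) n

      swap-sur : ∀ y → ∃[ x ] Swap x y
      swap-sur y with em {P = Shifted (g ∙ y)}
      ... | no n = g ∙ y , inj₂ (n , refl)
      ... | yes s with z , sz , e ← unshift s refl = z , inj₁ (sz , e)

      swap-fun : ∀ {x y y′} → Swap x y → Swap x y′ → y ≡ y′
      swap-fun (inj₁ (_ , e)) (inj₁ (_ , e′)) = trans (sym e) e′
      swap-fun (inj₂ (_ , e)) (inj₂ (_ , e′)) = ∙-inj g (trans e (sym e′))
      swap-fun (inj₁ (s , _)) (inj₂ (n , _)) = contradiction s n
      swap-fun (inj₂ (n , _)) (inj₁ (s , _)) = contradiction s n

    cantorBernstein : A ↔ B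
    cantorBernstein = bijective⇒↔ (proj₁ ∘ swap)
      (λ {x} {x′} e → swap-inj (proj₂ (swap x)) (subst (Swap x′) (sym e) (proj₂ (swap x′))))
      (λ y → proj₁ (swap-sur y) , swap-fun (proj₂ (swap _)) (proj₂ (swap-sur y)))

  recursion : {_<_ : A → A → Set r} → WellFounded _<_ →
              (F : ∀ i → (∀ {j} → j < i → B) → B) →
              Σ[ f ∈ (A → B) ] ∀ i → f i ≡ F i (λ {j} _ → f j)
  recursion {B = B} {_<_ = _<_} wf F =
    All.wfRec wf _ (λ _ → B) F , λ i → FixPoint.unfold-wfRec wf (λ _ → B) F
      (λ i eq → cong (F i) (implicit-extensionality ext (ext eq))) {i}

  minimal : {_<_ : A → A → Set r} → WellFounded _<_ → (P : A → Set p) →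
            ∃ P → ∃[ x ] P x × (∀ y → y < x → ¬ P y)
  minimal {_<_ = _<_} wf P (x , px) = go x (wf x) px
    where
    go : ∀ x → Acc _<_ x → P x → ∃[ x ] P x × (∀ y → y < x → ¬ P y)
    go x (acc rs) px with em {P = ∃[ y ] y < x × P y}
    ... | yes (y , lt , py) = go y (rs lt) py
    ... | no n = x , px , λ y lt py → n (y , lt , py)

  -- The well-ordering theorem

  module Zermelo (X : Set ℓ) where

    private
      _⊆ᵇ_ : (X → Bool) → (X → Bool) → Set ℓ
      S ⊆ᵇ R = ∀ x → T (S x) → T (R x)

      set : (X → Set p) → X → Bool
      set P x = isYes (em {P = P x})

      -- The answer of `em` is a definite point outside `S` that depends on `S` only, hence a choice
      -- function on complements.
      Picked : (X → Bool) → X → Set ℓ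
      Picked S x = Σ[ n ∈ ¬ T (S x) ] em {P = ∃[ y ] ¬ T (S y)} ≡ yes (x , n)

      picked-unique : ∀ {S x y} → Picked S x → Picked S y → x ≡ y
      picked-unique (_ , e) (_ , e′) with trans (sym e) e′
      ... | refl = refl

      picked : ∀ {S x} → ¬ T (S x) → ∃ (Picked S)
      picked {S} {x} n with em {P = ∃[ y ] ¬ T (S y)}
      ... | yes (y , m) = y , m , refl
      ... | no ne = contradiction (x , n) ne

      next : (X → Bool) → X → Bool
      next S = set (λ x → T (S x) ⊎ Picked S x)

      ⋃ : {I : Set ℓ} → (I → X → Bool) → X → Bool
      ⋃ F = set (λ x → ∃[ i ] T (F i x))

      -- Zermelo's chain of sets. Subsets are Bool-valued so that they form a type in `Set ℓ`;
      -- together with the truncation of membership in the tower, this allows a union over all tower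
      -- sets with a given property, although `Tower` itself is large.
      data Tower : (X → Bool) → Set (lsuc ℓ) where
        nextᵗ : ∀ {S} → Tower S → Tower (next S)
        ⋃ᵗ    : {I : Set ℓ} {F : I → X → Bool} → (∀ i → Tower (F i)) → Tower (⋃ F)

      ⊆next : ∀ {S} → S ⊆ᵇ next S
      ⊆next x p = squash (inj₁ p)

      ⊆-antisym : ∀ {S R} → S ⊆ᵇ R → R ⊆ᵇ S → S ≡ R
      ⊆-antisym {S} {R} p q = ext λ x → go (S x) (R x) (p x) (q x)
        where
        go : ∀ u v → (T u → T v) → (T v → T u) → u ≡ v
        go true  true  _ _ = refl
        go false false _ _ = refl
        go true  false f _ = ⊥-elim (f tt)
        go false true  _ g = ⊥-elim (g tt)

      ⋃-linear : ∀ {I : Set ℓ} {F : I → X → Bool} {S} →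
                 (∀ i → F i ⊆ᵇ S ⊎ next S ⊆ᵇ F i) → ⋃ F ⊆ᵇ S ⊎ next S ⊆ᵇ ⋃ F
      ⋃-linear {F = F} {S} lin with em {P = ∀ i → F i ⊆ᵇ S}
      ... | yes h = inj₁ λ x p → case unsquash p of λ (i , q) → h i x q
      ... | no n with i , ni ← ¬∀⇒∃¬ n with lin i
      ...   | inj₁ q = contradiction q ni
      ...   | inj₂ q = inj₂ λ x p → squash (i , q x p)

      -- Induction on `S`, for an `R` already known to be comparable with the whole tower; `linear`
      -- then inducts on the other set. The alternative `next R ⊆ᵇ S` is sharper than `R ⊆ᵇ S`:
      -- nothing lies strictly between `R` and `next R`, which is what carries the induction past a
      -- successor.
      linear-next : ∀ {R S} → (∀ {Q} → Tower Q → R ⊆ᵇ Q ⊎ next Q ⊆ᵇ R) →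
                    Tower S → S ⊆ᵇ R ⊎ next R ⊆ᵇ S
      linear-next ih (⋃ᵗ t) = ⋃-linear (λ i → linear-next ih (t i))
      linear-next ih (nextᵗ t) with linear-next ih t
      ... | inj₂ q = inj₂ λ x → ⊆next x ∘ q x
      ... | inj₁ S⊆R with ih t
      ...   | inj₂ q = inj₁ q
      ...   | inj₁ R⊆S rewrite ⊆-antisym S⊆R R⊆S = inj₂ λ _ → id

      linear : ∀ {S R} → Tower S → Tower R → S ⊆ᵇ R ⊎ next R ⊆ᵇ S
      linear (⋃ᵗ t) u = ⋃-linear (λ i → linear (t i) u)
      linear (nextᵗ t) u with linear t u
      ... | inj₂ q = inj₂ λ x → ⊆next x ∘ q x
      ... | inj₁ S⊆R with linear-next (linear t) u
      ...   | inj₂ q = inj₁ q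
      ...   | inj₁ R⊆S rewrite ⊆-antisym S⊆R R⊆S = inj₂ λ _ → id

      -- The largest stage of the tower that omits x; x is then picked next.
      Omitting : X → Set ℓ
      Omitting x = Σ[ S ∈ (X → Bool) ] ∥ Tower S × ¬ T (S x) ∥

      stage : X → X → Bool
      stage x = ⋃ {I = Omitting x} proj₁

      stageᵗ : ∀ x → Tower (stage x)
      stageᵗ x = ⋃ᵗ (λ (S , p) → proj₁ (unsquash p))

      stage-omits : ∀ {x} → ¬ T (stage x x)
      stage-omits p with (S , q) , r ← unsquash p = proj₂ (unsquash q) r

      omits⇒⊆stage : ∀ {S x} → Tower S → ¬ T (S x) → S ⊆ᵇ stage x
      omits⇒⊆stage t n y p = squash ((_ , squash (t , n)) , p)

      -- If `next (stage x)` omitted `x`, it would lie inside `stage x` by maximality, although it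
      -- contains a picked point outside.
      stage-picked : ∀ x → Picked (stage x) x
      stage-picked x with em {P = T (next (stage x) x)}
      ... | yes p with unsquash p
      ...   | inj₁ q = contradiction q stage-omits
      ...   | inj₂ q = q
      stage-picked x | no n with y , q ← picked {stage x} {x} stage-omits =
        contradiction (omits⇒⊆stage (nextᵗ (stageᵗ x)) n y (squash (inj₂ q))) (proj₁ q)

      compare : Trichotomous _≡_ (λ x y → T (stage y x))
      compare x y with linear (stageᵗ x) (stageᵗ y)
      ... | inj₂ q = tri> x∌ x≢ y∈
        where
        y∈ : T (stage x y)
        y∈ = q y (squash (inj₂ (stage-picked y)))
        x≢ : x ≢ y
        x≢ refl = stage-omits y∈
        x∌ : ¬ T (stage y x)
        x∌ p = stage-omits (q x (⊆next x p))
      ... | inj₁ p with linear (stageᵗ y) (stageᵗ x)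
      ...   | inj₂ q = tri< x∈ x≢ λ r → stage-omits (p y r)
        where
        x∈ : T (stage y x)
        x∈ = q x (squash (inj₂ (stage-picked x)))
        x≢ : x ≢ y
        x≢ refl = stage-omits x∈
      ...   | inj₁ q = tri≈ (λ r → stage-omits (q x r)) x≡y (λ r → stage-omits (p y r))
        where
        x≡y : x ≡ y
        x≡y = picked-unique (stage-picked x)
                (subst (λ S → Picked S y) (⊆-antisym q p) (stage-picked y))

      <-trans : Transitive (λ x y → T (stage y x))
      <-trans {x} {y} {z} x<y y<z with linear (stageᵗ y) (stageᵗ z)
      ... | inj₁ p = p x x<y
      ... | inj₂ q = contradiction (q y (⊆next y y<z)) stage-omits

      accessible : ∀ {S} → Tower S → ∀ x → T (S x) → Acc (λ x y → T (stage y x)) x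
      accessible (⋃ᵗ t) x p with i , q ← unsquash p = accessible (t i) x q
      accessible (nextᵗ {S} t) x p with unsquash p
      ... | inj₁ q = accessible t x q
      ... | inj₂ (n , e) = acc λ {y} y<x → accessible t y (below y y<x)
        where
        below : stage x ⊆ᵇ S
        below with linear (stageᵗ x) t
        ... | inj₁ q = q
        ... | inj₂ q = contradiction (q x p) stage-omits

    wellOrder : WO X
    wellOrder = record
      { _<_     = λ x y → Lift ℓ (T (stage y x))
      ; <-trans = λ p q → lift (<-trans (lower p) (lower q))
      ; compare = cmp
      ; wf      = λ x → lifted (accessible (nextᵗ (stageᵗ x)) x
                                  (squash (inj₂ (stage-picked x))))
      }
      where
      cmp : Trichotomous _≡_ (λ x y → Lift ℓ (T (stage y x)))
      cmp x y with compare x y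
      ... | tri< p n q = tri< (lift p) n (q ∘ lower)
      ... | tri≈ p n q = tri≈ (p ∘ lower) n (q ∘ lower)
      ... | tri> p n q = tri> (p ∘ lower) n (lift q)
      lifted : ∀ {x} → Acc (λ x y → T (stage y x)) x →
               Acc (λ x y → Lift ℓ (T (stage y x))) x
      lifted (acc rs) = acc λ y<x → lifted (rs (lower y<x))

  open Zermelo using () renaming (wellOrder to zermelo) public

  -- Comparability of cardinals, initial well-orders, induction on cardinals

  module _ {X : Set ℓ} (w : WO X) where
    open WO w

    Seg : X → Set ℓ
    Seg i = Σ[ j ∈ X ] ∥ j < i ∥

    segWO : ∀ i → WO (Seg i)
    segWO i = WO-pullback sub-↣ w

    module _ (Y : Set b) where

      private
        Fresh : ∀ i → (∀ {j} → j < i → Maybe Y) → Y → Set _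
        Fresh i g y = ∀ {j} (j<i : j < i) → g j<i ≢ just y

        pick : ∀ i → (∀ {j} → j < i → Maybe Y) → Maybe Y
        pick i g with em {P = ∃ (Fresh i g)}
        ... | yes (y , _) = just y
        ... | no _        = nothing

        pick-fresh : ∀ {i y} {g : ∀ {j} → j < i → Maybe Y} → pick i g ≡ just y → Fresh i g y
        pick-fresh {i} {g = g} e with em {P = ∃ (Fresh i g)}
        pick-fresh refl | yes (_ , q) = q

        pick-exists : ∀ {i} {g : ∀ {j} → j < i → Maybe Y} → ∃ (Fresh i g) →
                      ∃[ y ] pick i g ≡ just y
        pick-exists {i} {g} q with em {P = ∃ (Fresh i g)}
        ... | yes (y , _) = y , refl
        ... | no n        = contradiction q n

        f : X → Maybe Y
        f = proj₁ (recursion wf pick)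

        unfold : ∀ i → f i ≡ pick i (λ {j} _ → f j)
        unfold = proj₂ (recursion wf pick)

        f-fresh : ∀ {i j y} → f i ≡ just y → j < i → f j ≢ just y
        f-fresh {i} e = pick-fresh (trans (sym (unfold i)) e)

      -- Recursion along `X` gives each index a value not taken before, while one exists. If this
      -- fails at `i`, every `y` was taken below `i`, and an index where it was taken identifies it.
      comparable : (X ↣ Y) ⊎ (∃[ i ] Y ↣ Seg i)
      comparable with em {P = ∀ i → ∃[ y ] f i ≡ just y}
      ... | yes total = inj₁ (mk↣ {to = proj₁ ∘ total} inj)
        where
        inj : Injective _≡_ _≡_ (proj₁ ∘ total)
        inj {i} {j} e with compare i j
        ... | tri≈ _ i≡j _ = i≡j
        ... | tri< i<j _ _ = contradiction (trans (proj₂ (total i)) (cong just e))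
                                           (f-fresh (proj₂ (total j)) i<j)
        ... | tri> _ _ j<i = contradiction (trans (proj₂ (total j)) (cong just (sym e)))
                                           (f-fresh (proj₂ (total i)) j<i)
      ... | no ¬total with i , ni ← ¬∀⇒∃¬ ¬total =
        inj₂ (i , mk↣ {to = λ y → proj₁ (hit y) , squash (proj₁ (proj₂ (hit y)))}
          λ {y} {y′} e → just-injective (trans (sym (proj₂ (proj₂ (hit y))))
            (trans (cong (f ∘ proj₁) e) (proj₂ (proj₂ (hit y′))))))
        where
        hit : ∀ y → ∃[ j ] j < i × f j ≡ just y
        hit y with em {P = ∃[ j ] j < i × f j ≡ just y}
        ... | yes h = h
        ... | no n with z , e ← pick-exists {i} (y , λ {j} j<i fj → n (j , j<i , fj)) =
          contradiction (z , trans (unfold i) e) ni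

  ↣-total : (X : Set ℓ) (Y : Set b) → (X ↣ Y) ⊎ (Y ↣ X)
  ↣-total X Y with comparable (zermelo X) Y
  ... | inj₁ f       = inj₁ f
  ... | inj₂ (_ , f) = inj₂ (↣-trans f sub-↣)

  Initial : {X : Set ℓ} → WO X → Set ℓ
  Initial {X = X} w = ∀ i → ¬ (X ↣ Seg w i)

  -- Take the least `i` whose segment still receives `X` and pull its order back. A segment of the
  -- new order receiving `X` would give one below `i`.
  initial : (X : Set ℓ) → Σ (WO X) Initial
  initial X with em {P = ∃[ i ] X ↣ Seg (zermelo X) i}
  ... | no n = zermelo X , λ i f → n (i , f)
  ... | yes short with i , f , least ← minimal (WO.wf (zermelo X)) _ short =
    w , λ j g → least (proj₁ (f ∙ j)) (unsquash (proj₂ (f ∙ j)))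
      (↣-trans g (mk↣ {to = λ (k , p) → proj₁ (f ∙ k) , p}
        λ e → sub-≡ (∙-inj f (sub-≡ (cong proj₁ e)))))
    where
    w : WO X
    w = WO-pullback f (segWO (zermelo X) i)

  -- Well-foundedness of `≺` comes from one well-order of `X`: a smaller set embeds in some segment,
  -- and passing to a still smaller set lowers the endpoint of that segment.
  cardinal-induction : (P : Set ℓ → Set p) → (∀ X → (∀ Y → Y ≺ X → P Y) → P X) → ∀ X → P X
  cardinal-induction P ind X = ind X λ Y Y≺X → case comparable (zermelo X) Y of λ where
      (inj₁ f)       → contradiction f (proj₂ Y≺X)
      (inj₂ (i , f)) → below (wf i) Y f
    where
    open WO (zermelo X)
    below : ∀ {i} → Acc _<_ i → ∀ Y → Y ↣ Seg (zermelo X) i → P Y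
    below {i} (acc rs) Y f = ind Y λ Z Z≺Y →
      case comparable (WO-pullback f (segWO (zermelo X) i)) Z of λ where
        (inj₁ g)       → contradiction g (proj₂ Z≺Y)
        (inj₂ (j , g)) → below (rs (unsquash (proj₂ (f ∙ j)))) Z
          (↣-trans g (mk↣ {to = λ (k , p) → proj₁ (f ∙ k) , p}
            λ e → sub-≡ (∙-inj f (sub-≡ (cong proj₁ e)))))

  -- Squares of infinite cardinals

  ⊎-↣-× : {X : Set ℓ} → ℕ ↣ X → (X ⊎ X) ↣ (X × X)
  ⊎-↣-× {X = X} n = mk↣ {to = h} inj
    where
    h : X ⊎ X → X × X
    h (inj₁ x) = n ∙ 0 , x
    h (inj₂ x) = n ∙ 1 , x
    inj : Injective _≡_ _≡_ h
    inj {inj₁ x} {inj₁ y} e = cong inj₁ (cong proj₂ e)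
    inj {inj₂ x} {inj₂ y} e = cong inj₂ (cong proj₂ e)
    inj {inj₁ x} {inj₂ y} e = contradiction (∙-inj n (cong proj₁ e)) λ ()
    inj {inj₂ x} {inj₁ y} e = contradiction (∙-inj n (cong proj₁ e)) λ ()

  Maybe-↣-⊎ : {X : Set ℓ} → X → Maybe X ↣ (X ⊎ X)
  Maybe-↣-⊎ {X = X} x₀ = mk↣ {to = h} inj
    where
    h : Maybe X → X ⊎ X
    h nothing  = inj₁ x₀
    h (just x) = inj₂ x
    inj : Injective _≡_ _≡_ h
    inj {nothing} {nothing} _ = refl
    inj {just x}  {just .x} refl = refl

  -- Gödel's order of X × X: pairs are compared by maximum first, so that an initial
  -- segment lies in a square of an initial segment of X.
  module Gödel {X : Set ℓ} (w : WO X) where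
    open WO w

    private
      max : X × X → X
      max (x , y) with compare x y
      ... | tri< _ _ _ = y
      ... | tri≈ _ _ _ = x
      ... | tri> _ _ _ = x

      max-upper : ∀ x y → ¬ (max (x , y) < x) × ¬ (max (x , y) < y)
      max-upper x y with compare x y
      ... | tri< _ _ n   = n , <-irrefl
      ... | tri≈ n refl _ = n , n
      ... | tri> n _ _   = <-irrefl , n

      keyed : (X × X) ↣ (X × (X × X))
      keyed = mk↣ {to = λ q → max q , q} (cong proj₂)

      UpTo : X → Set ℓ
      UpTo m = Σ[ x ∈ X ] ∥ ¬ (m < x) ∥

      UpTo-↣ : ∀ m → UpTo m ↣ Maybe (Seg w m)
      UpTo-↣ m = mk↣ {to = h} inj
        where
        h : UpTo m → Maybe (Seg w m)
        h (x , p) with compare x m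
        ... | tri< x<m _ _ = just (x , squash x<m)
        ... | tri≈ _ _ _   = nothing
        ... | tri> _ _ _   = nothing
        inj : Injective _≡_ _≡_ h
        inj {x , p} {y , q} e with compare x m | compare y m
        ... | tri> _ _ r    | _             = contradiction r (unsquash p)
        ... | _             | tri> _ _ r    = contradiction r (unsquash q)
        ... | tri≈ _ refl _ | tri≈ _ refl _ = sub-≡ refl
        ... | tri< _ _ _    | tri< _ _ _    = sub-≡ (cong proj₁ (just-injective e))
        inj {x , p} {y , q} () | tri< _ _ _ | tri≈ _ _ _
        inj {x , p} {y , q} () | tri≈ _ _ _ | tri< _ _ _

    order : WO (X × X)
    order = WO-pullback keyed (WO-× w (WO-× w w))

    segment : ∀ q → ∃[ m ] Seg order q ↣ (Maybe (Seg w m) × Maybe (Seg w m))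
    segment q = max q , ↣-trans (mk↣ {to = h} inj) (UpTo-↣ (max q) ×-↣ UpTo-↣ (max q))
      where
      bound : ∀ r → WO._<_ order r q → ∀ {x} → ¬ (max r < x) → ¬ (max q < x)
      bound r (inj₁ l)       n u = n (<-trans l u)
      bound r (inj₂ (e , _)) n u = n (subst (_< _) (sym e) u)
      h : Seg order q → UpTo (max q) × UpTo (max q)
      h (r@(x , y) , p) = (x , squash (bound r (unsquash p) (proj₁ (max-upper x y))))
                        , (y , squash (bound r (unsquash p) (proj₂ (max-upper x y))))
      inj : Injective _≡_ _≡_ h
      inj e = sub-≡ (cong₂ _,_ (cong (proj₁ ∘ proj₁) e) (cong (proj₁ ∘ proj₂) e))

  -- If `X × X` does not embed in `X`, then `X` embeds in a segment of Gödel's order, hence in the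
  -- square of `Maybe (Seg w m)`. When `Seg w m` is countable this makes `X` countable, a case
  -- settled separately; otherwise the induction hypothesis puts `X` into `Seg w m`, against
  -- initiality of `w`.
  ×-absorb : (X : Set ℓ) → ℕ ↣ X → (X × X) ↣ X
  ×-absorb = cardinal-induction _ λ X ih ℕ↣X → case em of λ where
      (yes X↣ℕ) → ↣-trans (X↣ℕ ×-↣ X↣ℕ) (↣-trans ℕ×ℕ↣ℕ ℕ↣X)
      (no X↣̸ℕ)  → step X ih X↣̸ℕ
    where
    step : ∀ X → (∀ Y → Y ≺ X → ℕ ↣ Y → (Y × Y) ↣ Y) → ¬ (X ↣ ℕ) → (X × X) ↣ X
    step X ih X↣̸ℕ with w , init ← initial X with comparable (Gödel.order w) X
    ... | inj₁ f = f
    ... | inj₂ (q , X↣Seg) with m , s ← Gödel.segment w q with ↣-total (Seg w m) ℕ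
    ...   | inj₁ S↣ℕ = contradiction
            (↣-trans X↣Seg (↣-trans s (↣-trans (M↣ℕ ×-↣ M↣ℕ) ℕ×ℕ↣ℕ))) X↣̸ℕ
      where
      M↣ℕ : Maybe (Seg w m) ↣ ℕ
      M↣ℕ = ↣-trans (Maybe-↣ S↣ℕ) (↣-trans (Maybe-↣-⊎ 0)
              (↣-trans (⊎-↣-× ↣-refl) ℕ×ℕ↣ℕ))
    ...   | inj₂ ℕ↣S = contradiction
            (↣-trans X↣Seg (↣-trans s (↣-trans (M↣S ×-↣ M↣S) S×S↣S))) (init m)
      where
      S×S↣S : (Seg w m × Seg w m) ↣ Seg w m
      S×S↣S = ih (Seg w m) (sub-↣ , init m) ℕ↣S
      M↣S : Maybe (Seg w m) ↣ Seg w m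
      M↣S = ↣-trans (Maybe-↣-⊎ (ℕ↣S ∙ 0)) (↣-trans (⊎-↣-× ℕ↣S) S×S↣S)

  ⊎-absorb : {X : Set ℓ} → ℕ ↣ X → (X ⊎ X) ↣ X
  ⊎-absorb {X = X} n = ↣-trans (⊎-↣-× n) (×-absorb X n)

  Maybe-absorb : {X : Set ℓ} → ℕ ↣ X → Maybe X ↣ X
  Maybe-absorb n = ↣-trans (Maybe-↣-⊎ (n ∙ 0)) (⊎-absorb n)

  Σ-absorb : {X : Set ℓ} {F : A → Set b} → ℕ ↣ X → A ↣ X → (∀ x → F x ↣ X) → Σ A F ↣ X
  Σ-absorb {X = X} n f g = ↣-trans (Σ-↣ f g) (×-absorb X n)

  -- Successor cardinals and their regularity

  record Successor (X Y : Set ℓ) : Set (lsuc ℓ) where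
    field
      order    : WO Y
      ↣̸        : ¬ (Y ↣ X)
      segments : ∀ i → Seg order i ↣ X

  -- Cut out of a well-order of `Z`, as its shortest segment not embedding in `X`, or as all of `Z`
  -- if no segment is long enough. This makes the successor embed in `Z`.
  successor : (X Z : Set ℓ) → ¬ (Z ↣ X) → ∃[ Y ] (Y ↣ Z) × Successor X Y
  successor X Z n with em {P = ∃[ i ] ¬ (Seg (zermelo Z) i ↣ X)}
  ... | no none = Z , ↣-refl , record
    { order = zermelo Z
    ; ↣̸ = n
    ; segments = λ i → case em of λ where
        (yes f) → f
        (no nf) → contradiction (i , nf) none
    }
  ... | yes some with i , ni , least ← minimal (WO.wf (zermelo Z)) _ some =
    Seg (zermelo Z) i , sub-↣ , record
    { order = segWO (zermelo Z) i
    ; ↣̸ = ni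
    ; segments = λ (j , p) → case em of λ where
        (yes f) → ↣-trans (mk↣ {to = λ ((k , _) , q) → k , q}
                            λ e → sub-≡ (sub-≡ (cong proj₁ e))) f
        (no nf) → contradiction nf (least j (unsquash p))
    }

  module _ {X Y : Set ℓ} (ℕ↣X : ℕ ↣ X) (s : Successor X Y) where
    open Successor s
    open WO order

    below-successor : X ↣ Y
    below-successor with ↣-total X Y
    ... | inj₁ f = f
    ... | inj₂ f = contradiction f ↣̸

    -- An unbounded `f` would cover `Y` by the sets of points up to `f x`. There are at most X of
    -- them, each of size at most X + 1 (the value `nothing` of `place` stands for `f x` itself), so
    -- `Y` would embed in `X`.
    regular : A ↣ X → (f : A → Y) → ∃[ j ] ∀ x → f x < j
    regular {A = A} A↣X f with em {P = ∃[ j ] ∀ x → f x < j}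
    ... | yes bounded = bounded
    ... | no unbounded = contradiction (↣-trans (mk↣ {to = h} inj)
            (↣-trans (A↣X ×-↣ Maybe-absorb ℕ↣X) (×-absorb X ℕ↣X))) ↣̸
      where
      over : ∀ j → ∃[ x ] ¬ (f x < j)
      over j = ¬∀⇒∃¬ λ b → unbounded (j , b)
      place : ∀ x → Y → Maybe (Seg order (f x))
      place x j with compare j (f x)
      ... | tri< j<fx _ _ = just (j , squash j<fx)
      ... | tri≈ _ _ _    = nothing
      ... | tri> _ _ _    = nothing
      place-inj : ∀ x {j k} → ¬ (f x < j) → ¬ (f x < k) → place x j ≡ place x k → j ≡ k
      place-inj x {j} {k} nj nk e with compare j (f x) | compare k (f x)
      ... | tri> _ _ p    | _             = contradiction p nj
      ... | _             | tri> _ _ p    = contradiction p nk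
      ... | tri≈ _ refl _ | tri≈ _ refl _ = refl
      ... | tri< _ _ _    | tri< _ _ _    = cong proj₁ (just-injective e)
      place-inj x _ _ () | tri< _ _ _ | tri≈ _ _ _
      place-inj x _ _ () | tri≈ _ _ _ | tri< _ _ _
      code : ∀ x → Y → Maybe X
      code x j = Maybe-↣ (segments (f x)) ∙ place x j
      h : Y → A × Maybe X
      h j = proj₁ (over j) , code (proj₁ (over j)) j
      inj : Injective _≡_ _≡_ h
      inj {j} {k} e = go (over j) (over k) (cong proj₁ e) (cong proj₂ e)
        where
        go : (u : ∃[ x ] ¬ (f x < j)) (v : ∃[ x ] ¬ (f x < k)) →
             proj₁ u ≡ proj₁ v → code (proj₁ u) j ≡ code (proj₁ v) k → j ≡ k
        go (x , nj) (.x , nk) refl e =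
          place-inj x nj nk (∙-inj (Maybe-↣ (segments (f x))) e)

-- Structures and K-embeddings

open Structure using (el; el-inj; fun; rel)
open _⊑_ using (incl; incl-el)

-- Carriers are abstract, so a copy of `M` elsewhere in `V` needs no transport of functions and
-- relations.
relabel : (M : Structure τ) (e : ∣ M ∣ → V _) → Injective _≡_ _≡_ e → Structure τ
relabel M e inj = record
  { Carrier = ∣ M ∣ ; el = e ; el-inj = inj ; fun = fun M ; rel = rel M }

≡⇒⇔ : ∀ {a} {A B : Set a} → A ≡ B → A ⇔ B
≡⇒⇔ refl = ⇔.refl

relabel-≅ : (M : Structure τ) (e : ∣ M ∣ → V _) (inj : Injective _≡_ _≡_ e) →
            M ≅ relabel M e inj
relabel-≅ M e inj = record
  { to = id
  ; isEmbedding = record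
    { injective = id
    ; fun-hom = λ F xs → cong (fun M F) (sym (map-id xs))
    ; rel-iff = λ R xs → ≡⇒⇔ (cong (rel M R) (sym (map-id xs)))
    }
  ; surjective = λ y → y , id
  }

module _ {M N : Structure τ} (f : M ≅ N) where
  private module f = _≅_ f

  ≅-from : ∣ N ∣ → ∣ M ∣
  ≅-from = proj₁ ∘ f.surjective

  ≅-to-from : ∀ b → f.to (≅-from b) ≡ b
  ≅-to-from b = proj₂ (f.surjective b) refl

  ≅-from-to : ∀ a → ≅-from (f.to a) ≡ a
  ≅-from-to a = IsEmbedding.injective f.isEmbedding (≅-to-from (f.to a))

  ≅-sym : N ≅ M
  ≅-sym = record
    { to = ≅-from
    ; isEmbedding = record
      { injective = λ {x} {y} e → trans (sym (≅-to-from x)) (trans (cong f.to e) (≅-to-from y))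
      ; fun-hom = λ F xs → e.injective (begin
          f.to (≅-from (fun N F xs))              ≡⟨ ≅-to-from _ ⟩
          fun N F xs                              ≡⟨ cong (fun N F) (roundtrip xs) ⟨
          fun N F (Vec.map f.to (Vec.map ≅-from xs)) ≡⟨ e.fun-hom F _ ⟨
          f.to (fun M F (Vec.map ≅-from xs))      ∎)
      ; rel-iff = λ R xs → ⇔.trans (≡⇒⇔ (cong (rel N R) (sym (roundtrip xs))))
                                   (⇔.sym (e.rel-iff R _))
      }
    ; surjective = λ a → f.to a , λ { refl → ≅-from-to a }
    }
    where
    module e = IsEmbedding f.isEmbedding
    open ≡-Reasoning
    roundtrip : ∀ {n} (xs : Vec ∣ N ∣ n) → Vec.map f.to (Vec.map ≅-from xs) ≡ xs
    roundtrip xs = trans (sym (map-∘ f.to ≅-from xs)) (trans (map-cong ≅-to-from xs) (map-id xs))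

module _ {M N : Structure τ} (M⊑N : M ⊑ N) where

  incl-inj : Injective _≡_ _≡_ (incl M⊑N)
  incl-inj = IsEmbedding.injective (_⊑_.isEmbedding M⊑N)

  incl-↣ : ∣ M ∣ ↣ ∣ N ∣
  incl-↣ = mk↣ incl-inj

  incl-unique : ∀ {a b} → el M a ≡ el N b → incl M⊑N a ≡ b
  incl-unique e = el-inj N (trans (incl-el M⊑N _) e)

  ⊑⇒⊆ : M ⊆ N
  ⊑⇒⊆ a = incl M⊑N a , incl-el M⊑N a

module Embeddings {τ : Vocabulary ℓ} (K : AbstractClass τ k) where
  open AbstractClass K
  open ClassNotions K

  private
    variable
      M N P : Structure τ

  inclusion : M ≤K N → ∣ M ∣ → ∣ N ∣
  inclusion M≤N = incl (≤K⇒⊑ M≤N)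

  inclusion-el : (M≤N : M ≤K N) → ∀ a → el N (inclusion M≤N a) ≡ el M a
  inclusion-el M≤N = incl-el (≤K⇒⊑ M≤N)

  inclusion-unique : (M≤N : M ≤K N) → ∀ {a b} → el M a ≡ el N b → inclusion M≤N a ≡ b
  inclusion-unique M≤N = incl-unique (≤K⇒⊑ M≤N)

  ≤K⇒⊆ : M ≤K N → M ⊆ N
  ≤K⇒⊆ M≤N = ⊑⇒⊆ (≤K⇒⊑ M≤N)

  ≤K-relabel : M ≤K N → {e : ∣ M ∣ → V ℓ} {d : ∣ N ∣ → V ℓ} →
               {e-inj : Injective _≡_ _≡_ e} {d-inj : Injective _≡_ _≡_ d} →
               (∀ a b → el M a ≡ el N b → e a ≡ d b) → relabel M e e-inj ≤K relabel N d d-inj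
  ≤K-relabel M≤N same = ≤K-resp-≅ (relabel-≅ _ _ _) (relabel-≅ _ _ _) same M≤N

  -- A K-embedding as a function on universes, its image being M relabelled.
  record KEmb (M N : Structure τ) : Set (lsuc ℓ ⊔ k) where
    field
      fn     : ∣ M ∣ → ∣ N ∣
      fn-inj : Injective _≡_ _≡_ fn
      image≤ : relabel M (el N ∘ fn) (fn-inj ∘ el-inj N) ≤K N

    label : ∣ M ∣ → V ℓ
    label = el N ∘ fn

    label-inj : Injective _≡_ _≡_ label
    label-inj = fn-inj ∘ el-inj N

    image : Structure τ
    image = relabel M label label-inj

  open KEmb using (fn; fn-inj; label; label-inj)

  ≤K⇒KEmb : M ≤K N → KEmb M N
  ≤K⇒KEmb {M} {N} M≤N = record
    { fn     = inclusion M≤N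
    ; fn-inj = incl-inj (≤K⇒⊑ M≤N)
    ; image≤ = ≤K-relabel M≤N λ a b e → trans (inclusion-el M≤N a) e
    }

  _⊙_ : KEmb N P → KEmb M N → KEmb M P
  _⊙_ {N} {P} {M} g f = record
    { fn     = fn g ∘ fn f
    ; fn-inj = fn-inj f ∘ fn-inj g
    ; image≤ = ≤K-trans (≤K-relabel (KEmb.image≤ f) λ a b e → cong (label g) (el-inj N e))
                        (KEmb.image≤ g)
    }

  ≅⇒KEmb : Model M → M ≅ N → KEmb M N
  ≅⇒KEmb {M} {N} m f = record
    { fn     = _≅_.to f
    ; fn-inj = IsEmbedding.injective (_≅_.isEmbedding f)
    ; image≤ = ≤K-resp-≅ (relabel-≅ M _ _) f
                 (λ a b e → cong (el N ∘ _≅_.to f) (el-inj M e)) (≤K-refl m)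
    }

  fromKEmbedding : KEmbedding M N → KEmb M N
  fromKEmbedding {M} f =
    ≤K⇒KEmb image≤N ⊙ ≅⇒KEmb (Model-resp-≅ (≅-sym iso) (≤K-modelˡ image≤N)) iso
    where open KEmbedding f

  fromKEmbedding-label : (f : KEmbedding M N) →
                         ∀ a → label (fromKEmbedding f) a ≡ KEmbedding.value f a
  fromKEmbedding-label f a = inclusion-el (KEmbedding.image≤N f) _

  toKEmbedding : KEmb M N → KEmbedding M N
  toKEmbedding {M} f = record
    { image = KEmb.image f ; iso = relabel-≅ M _ _ ; image≤N = KEmb.image≤ f }

  into-relabel : (f : KEmb M N) (e : ∣ N ∣ → V ℓ) (e-inj : Injective _≡_ _≡_ e) →
                 KEmb M (relabel N e e-inj)
  into-relabel {N = N} f e e-inj = record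
    { fn     = fn f
    ; fn-inj = fn-inj f
    ; image≤ = ≤K-relabel (KEmb.image≤ f) λ a b eq → cong e (el-inj N eq)
    }

  from-relabel : {e : ∣ M ∣ → V ℓ} {e-inj : Injective _≡_ _≡_ e} →
                 KEmb (relabel M e e-inj) N → KEmb M N
  from-relabel f = record { fn = fn f ; fn-inj = fn-inj f ; image≤ = KEmb.image≤ f }

  to-relabel : KEmb M N → {e : ∣ M ∣ → V ℓ} {e-inj : Injective _≡_ _≡_ e} →
               KEmb (relabel M e e-inj) N
  to-relabel f = record { fn = fn f ; fn-inj = fn-inj f ; image≤ = KEmb.image≤ f }

  Fix : ∀ {M N} → Structure τ → KEmb M N → Set (lsuc ℓ)
  Fix {M} A f = ∀ a x → el A a ≡ el M x → label f x ≡ el A a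

-- Fresh labels and unions of directed families

no-loop : {A : Set ℓ} {f : A → V ℓ} (a : A) → f a ≢ sup A f
no-loop a e = go _ a refl e
  where
  go : ∀ v {A} {f : A → V ℓ} a → sup A f ≡ v → f a ≢ v
  -- A child equal to its parent is in turn a child of itself, so the recursion descends through the
  -- tree.
  go (sup A f) a refl e = go (f a) a (sym e) refl

sup-injective : {A : Set ℓ} {f g : A → V ℓ} → sup A f ≡ sup A g → f ≡ g
sup-injective refl = refl

module Unions (em : ∀ {a} → ExcludedMiddle a) (ext : ∀ {a b} → Extensionality a b) where
  open Sets em ext

  -- Renames the target of `g` so that `g` becomes an inclusion. The old labels `t` only keep the
  -- fresh ones distinct from each other.
  extend-labels : {A B : Set ℓ} {g : A → B} {l : A → V ℓ} {t : B → V ℓ} →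
                  Injective _≡_ _≡_ g → Injective _≡_ _≡_ l → Injective _≡_ _≡_ t →
                  Σ[ e ∈ (B → V ℓ) ] Injective _≡_ _≡_ e × (∀ a → e (g a) ≡ l a)
  extend-labels {ℓ = ℓ} {A} {B} {g} {l} {t} g-inj l-inj t-inj = e , e-inj , e-g
    where
    -- Having every label of A as a child, it differs from all of them.
    fresh : B → V ℓ
    fresh b = sup (Maybe A) (maybe′ l (t b))

    fresh-inj : Injective _≡_ _≡_ fresh
    fresh-inj eq = t-inj (cong (λ h → h nothing) (sup-injective eq))

    fresh≢ : ∀ {a b} → l a ≢ fresh b
    fresh≢ {a} = no-loop (just a)

    e : B → V ℓ
    e b with em {P = ∃[ a ] g a ≡ b}
    ... | yes (a , _) = l a
    ... | no _        = fresh b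

    e-inj : Injective _≡_ _≡_ e
    e-inj {b} {b′} eq with em {P = ∃[ a ] g a ≡ b} | em {P = ∃[ a ] g a ≡ b′}
    ... | yes (a , p) | yes (a′ , p′) = trans (sym p) (trans (cong g (l-inj eq)) p′)
    ... | yes _       | no _          = contradiction eq fresh≢
    ... | no _        | yes _         = contradiction (sym eq) fresh≢
    ... | no _        | no _          = fresh-inj eq

    e-g : ∀ a → e (g a) ≡ l a
    e-g a with em {P = ∃[ a′ ] g a′ ≡ g a}
    ... | yes (a′ , p) = cong l (g-inj p)
    ... | no n         = contradiction (a , refl) n

  module Directed {τ : Vocabulary ℓ} {I : Set ℓ} (M : I → Structure τ) (i₀ : I)
                  (directed : ∀ i j → ∃[ m ] (M i ⊑ M m) × (M j ⊑ M m)) where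
    open Vocabulary τ

    private
      Point : Set ℓ
      Point = Σ[ i ∈ I ] ∣ M i ∣

      lab : Point → V ℓ
      lab (i , a) = el (M i) a

      -- The argument `w` merely excludes the empty case; the point returned is that of `em` and
      -- depends on `v` alone. One point is thus selected for each label, in place of a quotient.
      choose : ∀ v → (∃[ q ] lab q ≡ v) → ∃[ q ] lab q ≡ v
      choose v w with em {P = ∃[ q ] lab q ≡ v}
      ... | yes r = r
      ... | no n  = contradiction w n

      choose-const : ∀ v w w′ → choose v w ≡ choose v w′
      choose-const v w w′ with em {P = ∃[ q ] lab q ≡ v}
      ... | yes r = refl
      ... | no n  = contradiction w n

      rep : Point → Point
      rep p = proj₁ (choose (lab p) (p , refl))

      rep-lab : ∀ p → lab (rep p) ≡ lab p
      rep-lab p = proj₂ (choose (lab p) (p , refl))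

      rep-eq : ∀ p q → lab p ≡ lab q → rep p ≡ rep q
      rep-eq p q e = go (lab p) e (p , refl)
        where
        go : ∀ v → v ≡ lab q → (w : ∃[ p ] lab p ≡ v) → proj₁ (choose v w) ≡ rep q
        go v refl w = cong proj₁ (choose-const v w (q , refl))

      Carrier : Set ℓ
      Carrier = Σ[ p ∈ Point ] ∥ rep p ≡ p ∥

      elᵁ : Carrier → V ℓ
      elᵁ (p , _) = lab p

      elᵁ-inj : Injective _≡_ _≡_ elᵁ
      elᵁ-inj {p , u} {q , v} e =
        sub-≡ (trans (sym (unsquash u)) (trans (rep-eq p q e) (unsquash v)))

      enc : Point → Carrier
      enc p = rep p , squash (rep-eq (rep p) p (rep-lab p))

      map-el-injective : ∀ {N : Structure τ} {n} (xs ys : Vec ∣ N ∣ n) →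
                         Vec.map (el N) xs ≡ Vec.map (el N) ys → xs ≡ ys
      map-el-injective [] [] _ = refl
      map-el-injective {N} (x ∷ xs) (y ∷ ys) e with e₁ , e₂ ← ∷-injective e =
        cong₂ _∷_ (el-inj N e₁) (map-el-injective {N} xs ys e₂)

      map-incl : ∀ {N P : Structure τ} (p : N ⊑ P) {n} (xs : Vec ∣ N ∣ n) →
                 Vec.map (el P) (Vec.map (incl p) xs) ≡ Vec.map (el N) xs
      map-incl {N} {P} p xs = trans (sym (map-∘ (el P) (incl p) xs)) (map-cong (incl-el p) xs)

      -- By directedness a finite tuple lies in one member, where symbols can be evaluated;
      -- `fun-agree` and `rel-agree` show that the member does not matter. Constants, with their
      -- empty tuple, are evaluated at `i₀`.
      collect : ∀ {n} (xs : Vec Carrier n) →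
                ∃[ i ] Σ[ ys ∈ Vec ∣ M i ∣ n ] Vec.map (el (M i)) ys ≡ Vec.map elᵁ xs
      collect [] = i₀ , [] , refl
      collect (((i , a) , _) ∷ xs) with j , ys , e ← collect xs with m , p , q ← directed i j =
        m , incl p a ∷ Vec.map (incl q) ys , cong₂ _∷_ (incl-el p a) (trans (map-incl q ys) e)

      module _ {i j n} {xs : Vec ∣ M i ∣ n} {ys : Vec ∣ M j ∣ n}
               (e : Vec.map (el (M i)) xs ≡ Vec.map (el (M j)) ys) where

        common : ∃[ m ] Σ[ p ∈ M i ⊑ M m ] Σ[ q ∈ M j ⊑ M m ]
                   Vec.map (incl p) xs ≡ Vec.map (incl q) ys
        common with m , p , q ← directed i j =
          m , p , q , map-el-injective {M m} _ _
                        (trans (map-incl p xs) (trans e (sym (map-incl q ys))))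

      fun-agree : ∀ F {i j} {xs : Vec ∣ M i ∣ _} {ys : Vec ∣ M j ∣ _} →
                  Vec.map (el (M i)) xs ≡ Vec.map (el (M j)) ys →
                  el (M i) (fun (M i) F xs) ≡ el (M j) (fun (M j) F ys)
      fun-agree F {i} {j} {xs} {ys} e with m , p , q , eq ← common e = begin
        el (M i) (fun (M i) F xs)                 ≡⟨ incl-el p _ ⟨
        el (M m) (incl p (fun (M i) F xs))        ≡⟨ cong (el (M m)) (p.fun-hom F xs) ⟩
        el (M m) (fun (M m) F (Vec.map (incl p) xs)) ≡⟨ cong (el (M m) ∘ fun (M m) F) eq ⟩
        el (M m) (fun (M m) F (Vec.map (incl q) ys)) ≡⟨ cong (el (M m)) (q.fun-hom F ys) ⟨
        el (M m) (incl q (fun (M j) F ys))        ≡⟨ incl-el q _ ⟩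
        el (M j) (fun (M j) F ys)                 ∎
        where
        open ≡-Reasoning
        module p = IsEmbedding (_⊑_.isEmbedding p)
        module q = IsEmbedding (_⊑_.isEmbedding q)

      rel-agree : ∀ R {i j} {xs : Vec ∣ M i ∣ _} {ys : Vec ∣ M j ∣ _} →
                  Vec.map (el (M i)) xs ≡ Vec.map (el (M j)) ys →
                  rel (M i) R xs ⇔ rel (M j) R ys
      rel-agree R {xs = xs} {ys} e with m , p , q , eq ← common e =
        ⇔.trans (IsEmbedding.rel-iff (_⊑_.isEmbedding p) R xs)
          (⇔.trans (≡⇒⇔ (cong (rel (M m) R) eq))
            (⇔.sym (IsEmbedding.rel-iff (_⊑_.isEmbedding q) R ys)))

    union : Structure τ
    union = record
      { Carrier = Carrier
      ; el      = elᵁ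
      ; el-inj  = elᵁ-inj
      ; fun     = λ F xs → let i , ys , _ = collect xs in enc (i , fun (M i) F ys)
      ; rel     = λ R xs → let i , ys , _ = collect xs in rel (M i) R ys
      }

    union-upper : ∀ i → M i ⊑ union
    union-upper i = record
      { incl        = inc
      ; incl-el     = inc-el
      ; isEmbedding = record
        { injective = λ {a} {b} e →
            el-inj (M i) (trans (sym (inc-el a)) (trans (cong elᵁ e) (inc-el b)))
        ; fun-hom = λ F xs → let j , ys , e = collect (Vec.map inc xs) in
            elᵁ-inj (trans (inc-el _) (trans (fun-agree F (sym (trans e (map-inc xs))))
              (sym (rep-lab (j , fun (M j) F ys)))))
        ; rel-iff = λ R xs → let _ , _ , e = collect (Vec.map inc xs) in
            rel-agree R (sym (trans e (map-inc xs)))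
        }
      }
      where
      inc : ∣ M i ∣ → Carrier
      inc a = enc (i , a)
      inc-el : ∀ a → elᵁ (inc a) ≡ el (M i) a
      inc-el a = rep-lab (i , a)
      map-inc : ∀ {n} (xs : Vec ∣ M i ∣ n) → Vec.map elᵁ (Vec.map inc xs) ≡ Vec.map (el (M i)) xs
      map-inc xs = trans (sym (map-∘ elᵁ inc xs)) (map-cong inc-el xs)

    union-covered : ∀ u → ∃[ i ] el union u ∈ M i
    union-covered ((i , a) , _) = i , a , refl

  -- Amalgams and orbital types

  module Amalgams {τ : Vocabulary ℓ} (K : AbstractClass τ k) where
    open AbstractClass K
    open ClassNotions K
    open Embeddings K
    open KEmb using (fn; fn-inj; label; label-inj; image; image≤)

    extend : ∀ {M N} (g : KEmb M N) (l : ∣ M ∣ → V ℓ) (l-inj : Injective _≡_ _≡_ l) →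
             Σ[ e ∈ (∣ N ∣ → V ℓ) ] Σ[ e-inj ∈ Injective _≡_ _≡_ e ]
               (∀ a → e (fn g a) ≡ l a) × relabel M l l-inj ≤K relabel N e e-inj
    extend {M} {N} g l l-inj with e , e-inj , e-g ← extend-labels (fn-inj g) l-inj (el-inj N) =
      e , e-inj , e-g ,
      ≤K-relabel (image≤ g) λ a b eq → trans (sym (e-g a)) (cong e (el-inj N eq))

    -- One step of SameType; under amalgamation it is already transitive.
    Same : (A : Structure τ) {N N′ : Structure τ} → ∣ N ∣ → ∣ N′ ∣ → Set (lsuc ℓ ⊔ k)
    Same A {N} {N′} b b′ =
      ∃[ P ] Σ[ f ∈ KEmb N P ] Σ[ g ∈ KEmb N′ P ] Fix A f × Fix A g × fn f b ≡ fn g b′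

    Fix-≤K : ∀ A {M N} (M≤N : M ≤K N) → Fix A (≤K⇒KEmb M≤N)
    Fix-≤K A M≤N a x e = trans (inclusion-el M≤N x) (sym e)

    amalgam-fix : ∀ {A M N R} (A≤M : A ≤K M) (A≤N : A ≤K N) (q : KEmb N R) →
                  (∀ a → label q (inclusion A≤N a) ≡ el M (inclusion A≤M a)) → Fix A q
    amalgam-fix A≤M A≤N q q-A a x e = trans (cong (label q) (sym (inclusion-unique A≤N e)))
                                        (trans (q-A a) (inclusion-el A≤M a))

    Same-sym : ∀ {A N N′} {b : ∣ N ∣} {b′ : ∣ N′ ∣} →
               Same A {N} {N′} b b′ → Same A {N′} {N} b′ b
    Same-sym (P , f , g , fix-f , fix-g , e) = P , g , f , fix-g , fix-f , sym e

    Same-KEmb : ∀ {A M N} (f : KEmb M N) → Fix A f → ∀ b → Same A {M} {N} b (fn f b)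
    Same-KEmb {A} f fix b = _ , f , ≤K⇒KEmb N≤N , fix , Fix-≤K A N≤N ,
                            sym (inclusion-unique N≤N refl)
      where N≤N = ≤K-refl (≤K-modelʳ (image≤ f))

    Same-restrict : ∀ {A B N N′} {b : ∣ N ∣} {b′ : ∣ N′ ∣} → A ⊆ B →
                    Same B {N} {N′} b b′ → Same A {N} {N′} b b′
    Same-restrict {A} {B} A⊆B (P , f , g , fix-f , fix-g , e) =
      P , f , g , restrict f fix-f , restrict g fix-g , e
      where
      restrict : ∀ {M} (f : KEmb M P) → Fix B f → Fix A f
      restrict f fix a x eq with b , b≡ ← A⊆B a = trans (fix b x (trans b≡ eq)) b≡

    Atomic⇒Same : ∀ {A} {s t : Triple A} → AtomicEquiv s t →
                  Same A {Triple.N s} {Triple.N t} (Triple.b s) (Triple.b t)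
    Atomic⇒Same {A} {s} {t} (P , f , g , fix-f , fix-g , e) =
      P , fromKEmbedding f , fromKEmbedding g ,
      (λ a x eq → trans (fromKEmbedding-label f x) (fix-f a x eq)) ,
      (λ a x eq → trans (fromKEmbedding-label g x) (fix-g a x eq)) ,
      el-inj P (trans (fromKEmbedding-label f _) (trans e (sym (fromKEmbedding-label g _))))

    Realizes : (A U : Structure τ) {N : Structure τ} → ∣ N ∣ → Set (lsuc ℓ ⊔ k)
    Realizes A U {N} b = Σ[ u ∈ ∣ U ∣ ] Same A {U} {N} u b

    module _ (amalgamation : Amalgamation) where

      -- The amalgamation property needs a common literal submodel, so `N₂` is first renamed to
      -- contain the image of `f`. Renaming the amalgam afterwards makes `N₁` a submodel of it.
      amalgamate : ∀ {M N₁ N₂} (f : KEmb M N₁) (g : KEmb M N₂) →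
                   ∃[ R ] N₁ ≤K R × Σ[ q ∈ KEmb N₂ R ] (∀ a → label q (fn g a) ≡ label f a)
      amalgamate {M} {N₁} {N₂} f g =
        let e , e-inj , e-g , M≤N₂ = extend g (label f) (label-inj f)
            R , f₁′ , f₂′ , fix₁ , fix₂ =
              amalgamation (image f) N₁ (relabel N₂ e e-inj) (image≤ f) M≤N₂
            f₁ = fromKEmbedding f₁′
            f₂ = fromKEmbedding f₂′
            d , d-inj , d-f₁ , N₁≤R = extend f₁ (el N₁) (el-inj N₁)
            meet : ∀ a → fn f₂ (fn g a) ≡ fn f₁ (fn f a)
            meet a = el-inj R (trans (fromKEmbedding-label f₂′ _)
              (trans (fix₂ a (fn g a) (sym (e-g a)))
                (sym (trans (fromKEmbedding-label f₁′ _) (fix₁ a (fn f a) refl)))))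
        in relabel R d d-inj , N₁≤R , into-relabel (from-relabel f₂) d d-inj ,
           λ a → trans (cong d (meet a)) (d-f₁ (fn f a))

      -- `P` and `Q` are amalgamated over the middle model `N₂`. Since `A` lies in `N₂`, its points
      -- have the same place in `Q` through `N₂` and through `N₃`, so `A` stays fixed.
      Same-trans : ∀ {A N₁ N₂ N₃} {b₁ : ∣ N₁ ∣} {b₂ : ∣ N₂ ∣} {b₃ : ∣ N₃ ∣} → A ≤K N₂ →
                   Same A {N₁} {N₂} b₁ b₂ → Same A {N₂} {N₃} b₂ b₃ → Same A {N₁} {N₃} b₁ b₃
      Same-trans {A} {N₁} {N₂} {N₃} {b₁} {b₂} {b₃} A≤N₂
        (P , f₁ , f₂ , fix₁ , fix₂ , e) (Q , g₁ , g₂ , fix₁′ , fix₂′ , e′)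
        with R , P≤R , q , q-g ← amalgamate f₂ g₁ =
        R , ≤K⇒KEmb P≤R ⊙ f₁ , q ⊙ g₂ ,
        (λ a x eq → trans (inclusion-el P≤R _) (fix₁ a x eq)) , fix₃ ,
        inclusion-unique P≤R (trans (cong (el P) e)
          (trans (sym (q-g b₂)) (cong (label q) e′)))
        where
        fix₃ : Fix A (q ⊙ g₂)
        fix₃ a x eq = begin
          label q (fn g₂ x)  ≡⟨ cong (label q) (el-inj Q same) ⟩
          label q (fn g₁ m)  ≡⟨ q-g m ⟩
          label f₂ m         ≡⟨ fix₂ a m m≡ ⟩
          el A a             ∎
          where
          open ≡-Reasoning
          m  = inclusion A≤N₂ a
          m≡ = sym (inclusion-el A≤N₂ a)
          same = trans (fix₂′ a x eq) (sym (fix₁′ a m m≡))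

      SameType⇒Same : ∀ {A} {s t : Triple A} → SameType s t →
                      Same A {Triple.N s} {Triple.N t} (Triple.b s) (Triple.b t)
      SameType⇒Same {s = s} {t} [ r ]⁺ = Atomic⇒Same {s = s} {t} r
      SameType⇒Same {s = s} (_∷_ {y = u} r rs) =
        Same-trans (Triple.M≤N u) (Atomic⇒Same {s = s} {u} r) (SameType⇒Same rs)

      Realizes-mono : ∀ {A U U′ N} {b : ∣ N ∣} → A ≤K U → U ≤K U′ →
                      Realizes A U {N} b → Realizes A U′ {N} b
      Realizes-mono {A} A≤U U≤U′ (u , same) =
        inclusion U≤U′ u ,
        Same-trans A≤U (Same-sym {A} (Same-KEmb {A} (≤K⇒KEmb U≤U′) (Fix-≤K A U≤U′) u)) same

  -- Transfinite chains

  WO⇒WellOrder : {A : Set ℓ} → WO A → WellOrder ℓ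
  WO⇒WellOrder {A = A} w = record
    -- The adjoined bottom provides a least index even for an empty segment, and is the place of the
    -- initial stage of a chain.
    { Index              = Maybe A
    ; _<_                = _<₋_ _<_
    ; isStrictTotalOrder = <₋-isStrictTotalOrder-≡ _<_ (isStrictTotalOrderᶜ record
        { isEquivalence = isEquivalence ; trans = <-trans ; compare = compare })
    ; wellFounded        = <₋-wellFounded _<_ wf
    ; 0#                 = nothing
    ; 0#-least           = λ i ()
    }
    where open WO w

  Monotone : ∀ {s r} {S : Set s} (δ : WellOrder ℓ) → (S → S → Set r) →
             (WellOrder.Index δ → S) → Set _
  Monotone δ _◁_ s = ∀ {x y} → WellOrder._<_ δ x y → s x ◁ s y

  module _ {I : Set ℓ} (w : WO I) {s r p} {S : Set s} (_◁_ : S → S → Set r)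
           (P : I → S → Set p) (s₀ : S)
           (step : ∀ i (g : Maybe (Seg w i) → S) →
                   Monotone (WO⇒WellOrder (segWO w i)) _◁_ g →
                   Σ[ t ∈ S ] P i t × (∀ x → g x ◁ t)) where
    open WO w

    private
      prefix : ∀ {i} → (∀ {j} → j < i → S) → Maybe (Seg w i) → S
      prefix g = maybe′ (λ (j , p) → g (unsquash p)) s₀

      Mono : ∀ {i} → (∀ {j} → j < i → S) → Set _
      Mono {i} g = Monotone (WO⇒WellOrder (segWO w i)) _◁_ (prefix g)

      -- The recursion cannot carry a proof that the earlier values form a chain, so this is tested
      -- by `em`. By `good` the test always succeeds along `f`.
      next : ∀ i → (∀ {j} → j < i → S) → S
      next i g with em {P = Mono g}
      ... | yes m = proj₁ (step i (prefix g) m)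
      ... | no _  = s₀

      next-spec : ∀ i (g : ∀ {j} → j < i → S) → Mono g →
                  P i (next i g) × (∀ x → prefix g x ◁ next i g)
      next-spec i g m with em {P = Mono g}
      ... | yes m′ = proj₂ (step i (prefix g) m′)
      ... | no n   = contradiction (λ {x} {y} → m {x} {y}) n

      f : I → S
      f = proj₁ (recursion wf next)

      Good : I → Set _
      Good i = P i (f i) × s₀ ◁ f i × (∀ {j} → j < i → f j ◁ f i)

      good : ∀ {i} → Acc _<_ i → Good i
      good {i} (acc rs) rewrite proj₂ (recursion wf next) i =
        let p , q = next-spec i (λ {j} _ → f j) mono
        in p , q nothing , λ j<i → q (just (_ , squash j<i))
        where
        mono : Mono {i} (λ {j} _ → f j)
        mono ⊥₋<[ j , p ] = proj₁ (proj₂ (good (rs (unsquash p))))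
        mono ([_] {l = j , p} lt) = proj₂ (proj₂ (good (rs (unsquash p)))) lt

    transfiniteChain : Σ[ g ∈ (I → S) ] Monotone (WO⇒WellOrder w) _◁_ (maybe′ g s₀) ×
                         (∀ i → P i (g i))
    transfiniteChain = f , mono , λ i → proj₁ (good (wf i))
      where
      mono : Monotone (WO⇒WellOrder w) _◁_ (maybe′ f s₀)
      mono ⊥₋<[ i ] = proj₁ (proj₂ (good (wf i)))
      mono ([_] {l = i} lt) = proj₂ (proj₂ (good (wf i))) lt

-- Fragmented AECs
module Fragment (em : ∀ {a} → ExcludedMiddle a) (ext : ∀ {a b} → Extensionality a b)
                {τ : Vocabulary ℓ} (K : FragmentedAEC τ k) where
  open FragmentedAEC K
  open Sets em ext
  open Unions em ext
  open Embeddings abstractClass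
  open Amalgams abstractClass
  open KEmb using (fn; fn-inj; label; label-inj; image; image≤)

  -- Unions of chains of models of one cardinality

  module Chain (δ : WellOrder ℓ) {M : WellOrder.Index δ → Structure τ}
               (increasing : Increasing δ M) where
    open WellOrder δ
    open IsStrictTotalOrder isStrictTotalOrder using (compare) renaming (trans to <-trans)
    open Increasing increasing

    private
      _≼_ : Index → Index → Set ℓ
      i ≼ j = i ≡ j ⊎ i < j

      ≼⇒≤K : ∀ {i j} → i ≼ j → M i ≤K M j
      ≼⇒≤K (inj₁ refl) = ≤K-refl (model _)
      ≼⇒≤K (inj₂ i<j)  = mono i<j

      _⊔′_ : Index → Index → Index
      i ⊔′ j with compare i j
      ... | tri< _ _ _ = j
      ... | tri≈ _ _ _ = i
      ... | tri> _ _ _ = i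

      ⊔′-upperˡ : ∀ i j → i ≼ (i ⊔′ j)
      ⊔′-upperˡ i j with compare i j
      ... | tri< i<j _ _ = inj₂ i<j
      ... | tri≈ _ _ _   = inj₁ refl
      ... | tri> _ _ _   = inj₁ refl

      ⊔′-upperʳ : ∀ i j → j ≼ (i ⊔′ j)
      ⊔′-upperʳ i j with compare i j
      ... | tri< _ _ _   = inj₁ refl
      ... | tri≈ _ i≡j _ = inj₁ (sym i≡j)
      ... | tri> _ _ j<i = inj₂ j<i

      ⊔′-0# : ∀ i → i ⊔′ 0# ≡ i
      ⊔′-0# i with compare i 0#
      ... | tri< i<0 _ _ = contradiction i<0 (0#-least i)
      ... | tri≈ _ _ _   = refl
      ... | tri> _ _ _   = refl

      ⊔′-mono : ∀ i {j j′} → j < j′ → (i ⊔′ j) ≼ (i ⊔′ j′)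
      ⊔′-mono i {j} {j′} j<j′ with compare i j | compare i j′
      ... | tri< _ _ _   | tri< _ _ _ = inj₂ j<j′
      ... | tri< i<j _ _ | tri≈ n _ _ = contradiction (<-trans i<j j<j′) n
      ... | tri< i<j _ _ | tri> n _ _ = contradiction (<-trans i<j j<j′) n
      ... | tri≈ _ _ _   | tri< l _ _ = inj₂ l
      ... | tri≈ _ _ _   | tri≈ _ _ _ = inj₁ refl
      ... | tri≈ _ _ _   | tri> _ _ _ = inj₁ refl
      ... | tri> _ _ _   | tri< l _ _ = inj₂ l
      ... | tri> _ _ _   | tri≈ _ _ _ = inj₁ refl
      ... | tri> _ _ _   | tri> _ _ _ = inj₁ refl

    union-exists : ∃[ U ] IsUnion δ M U
    union-exists = union , record { upper = union-upper ; covered = union-covered }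
      where
      open Directed M 0# (λ i j →
        i ⊔′ j , ≤K⇒⊑ (≼⇒≤K (⊔′-upperˡ i j)) , ≤K⇒⊑ (≼⇒≤K (⊔′-upperʳ i j)))

    module _ {U : Structure τ} (isUnion : IsUnion δ M U) where
      open IsUnion isUnion

      -- The restricted chain axiom bounds only the first member of a chain; to bound M i,
      -- replace the members below i by M i.
      union-≤K : (∀ i → ∣ M i ∣ ↔ ∣ U ∣) → Model U × (∀ i → M i ≤K U)
      union-≤K sizes = proj₁ (bound 0#) , λ i →
        subst (λ j → M j ≤K U) (⊔′-0# i) (proj₂ (bound i))
        where
        bound : ∀ i → Model U × M (i ⊔′ 0#) ≤K U
        bound i = restrictedChain δ (λ j → M (i ⊔′ j))
          (record { model = λ j → model (i ⊔′ j) ; mono = λ j<j′ → ≼⇒≤K (⊔′-mono i j<j′) }) U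
          (record
            { upper = λ j → upper (i ⊔′ j)
            ; covered = λ u → let j , a , e = covered u
                                  b , e′ = ≤K⇒⊆ (≼⇒≤K (⊔′-upperʳ i j)) a
                              in j , b , trans e′ e
            }) (0# , sizes (i ⊔′ 0#))

      union-size : {X : Set ℓ} → ℕ ↣ X → Index ↣ X → (∀ i → ∣ M i ∣ ↔ X) → ∣ U ∣ ↔ X
      union-size {X} ℕ↣X Index↣X sizes = cantorBernstein
        (↣-trans (mk↣ {to = place} place-inj) (Σ-absorb ℕ↣X Index↣X (λ i → ↔⇒↣ (sizes i))))
        (↣-trans (↔⇒↣ (↔-sym (sizes 0#))) (incl-↣ (upper 0#)))
        where
        place : ∣ U ∣ → Σ[ i ∈ Index ] ∣ M i ∣
        place u = let i , a , _ = covered u in i , a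
        place-inj : Injective _≡_ _≡_ place
        place-inj {u} {v} e = el-inj U (trans (sym (proj₂ (proj₂ (covered u))))
          (trans (cong (λ (i , a) → el (M i) a) e) (proj₂ (proj₂ (covered v)))))

  -- Hulls of prescribed cardinality

  ℕ↣LS : ℕ ↣ LS
  ℕ↣LS = ↣-trans (mk↣ {to = inj₂} λ { refl → refl }) (proj₁ (proj₁ isLS))

  -- The size is exact because X points of `M` are thrown in with the range of `s`. Since `s` need
  -- not be injective, the bound for `LS` is applied to the image.
  hull : ∀ {M} {X A : Set ℓ} → Model M → LS ↣ X → X ↣ ∣ M ∣ → A ↣ X → (s : A → ∣ M ∣) →
         ∃[ M₀ ] M₀ ≤K M × (∣ M₀ ∣ ↔ X) × (∀ a → el M (s a) ∈ M₀)
  hull {M} {X} {A} m LS↣X X↣M A↣X s = M₀ , M₀≤M , cantorBernstein M₀↣X X↣M₀ , s∈M₀ ∘ inj₁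
    where
    s⁺ : A ⊎ X → ∣ M ∣
    s⁺ = [ s , (X↣M ∙_) ]′
    ℕ↣X : ℕ ↣ X
    ℕ↣X = ↣-trans ℕ↣LS LS↣X
    Im : Set ℓ
    Im = Σ[ b ∈ ∣ M ∣ ] ∥ ∃[ z ] s⁺ z ≡ b ∥
    cut : ∃[ M₀ ] M₀ ≤K M × ((b : Im) → el M (proj₁ b) ∈ M₀) × (∣ M₀ ∣ ↣ (Im ⊎ LS))
    cut = proj₂ (proj₁ isLS) M m Im sub-↣
    M₀ : Structure τ
    M₀ = proj₁ cut
    M₀≤M : M₀ ≤K M
    M₀≤M = proj₁ (proj₂ cut)
    s∈M₀ : ∀ z → el M (s⁺ z) ∈ M₀
    s∈M₀ z = proj₁ (proj₂ (proj₂ cut)) (s⁺ z , squash (z , refl))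
    M₀↣X : ∣ M₀ ∣ ↣ X
    M₀↣X = ↣-trans (proj₂ (proj₂ (proj₂ cut)))
      (↣-trans (↣-trans (image-↣ s⁺) (↣-trans (A↣X ⊎-↣ ↣-refl) (⊎-absorb ℕ↣X)) ⊎-↣ LS↣X)
        (⊎-absorb ℕ↣X))
    X↣M₀ : X ↣ ∣ M₀ ∣
    X↣M₀ = mk↣ {to = proj₁ ∘ s∈M₀ ∘ inj₂} λ {x} {y} e → ∙-inj X↣M (el-inj M
      (trans (sym (proj₂ (s∈M₀ (inj₂ x)))) (trans (cong (el M₀) e) (proj₂ (s∈M₀ (inj₂ y))))))

  bounded : (δ : WellOrder ℓ) {M : WellOrder.Index δ → Structure τ} {X : Set ℓ} →
            Increasing δ M → ℕ ↣ X → WellOrder.Index δ ↣ X → (∀ i → ∣ M i ∣ ↔ X) →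
            ∃[ U ] IsUnion δ M U × Model U × (∣ U ∣ ↔ X) × (∀ i → M i ≤K U)
  bounded δ {M} {X} inc ℕ↣X δ↣X sizes = case union-exists of λ where
      (U , isUnion) →
        let size = union-size isUnion ℕ↣X δ↣X sizes
            m , upper = union-≤K isUnion λ i → ↔-trans (sizes i) (↔-sym size)
        in U , isUnion , m , size , upper
    where open Chain δ {M} inc

  -- Realizing types

  module _ (amalgamation : Amalgamation) where

    realize : ∀ {A U N} {Z : Set ℓ} → LS ↣ Z → ∣ U ∣ ↔ Z → A ≤K U → A ≤K N → (b : ∣ N ∣) →
              ∃[ U′ ] U ≤K U′ × (∣ U′ ∣ ↔ Z) × Realizes A U′ {N} b
    realize {A} {U} {N} {Z} LS↣Z U↔Z A≤U A≤N b =
      case amalgamate amalgamation (≤K⇒KEmb A≤U) (≤K⇒KEmb A≤N) of λ where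
        (R , U≤R , q , q-A) → case
          hull (≤K-modelʳ U≤R) LS↣Z (↣-trans (↔⇒↣ (↔-sym U↔Z)) (incl-↣ (≤K⇒⊑ U≤R)))
               (↣-trans (Maybe-↣ (↔⇒↣ U↔Z)) (Maybe-absorb (↣-trans ℕ↣LS LS↣Z)))
               (maybe′ (inclusion U≤R) (fn q b)) of λ where
            (U′ , U′≤R , U′↔Z , s∈U′) →
              U′ ,
              coherence U U′ R
                (λ a → proj₁ (s∈U′ (just a)) ,
                       trans (proj₂ (s∈U′ (just a))) (inclusion-el U≤R a)) U≤R U′≤R ,
              U′↔Z , proj₁ (s∈U′ nothing) , R , ≤K⇒KEmb U′≤R , q , Fix-≤K A U′≤R ,
              amalgam-fix A≤U A≤N q q-A ,
              inclusion-unique U′≤R (proj₂ (s∈U′ nothing))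

    module _ {X Y : Set ℓ} (LS↣X : LS ↣ X) (succ : Successor X Y) where
      open Successor succ

      private
        ℕ↣X : ℕ ↣ X
        ℕ↣X = ↣-trans ℕ↣LS LS↣X
        X↣Y : X ↣ Y
        X↣Y = below-successor ℕ↣X succ
        ℕ↣Y : ℕ ↣ Y
        ℕ↣Y = ↣-trans ℕ↣X X↣Y
        LS↣Y : LS ↣ Y
        LS↣Y = ↣-trans LS↣X X↣Y

      -- Two models are involved because realizing the types over submodels of `M` creates new
      -- submodels, whose types are left to later steps.
      SaturatedOver : Structure τ → Structure τ → Set (lsuc ℓ ⊔ k)
      SaturatedOver M U =
        ∀ {A N} → A ≤K M → ∣ A ∣ ↔ X → A ≤K N → (b : ∣ N ∣) → Realizes A U {N} b

      -- The Y × X types are realized one after another.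
      module _ {M : Structure τ} (m : Model M) (M↔Y : ∣ M ∣ ↔ Y)
               {F : Y → Structure τ} (F≤M : ∀ i → F i ≤K M)
               {c : ∀ i → Triple (F i) → X} (c-inj : ∀ i → Injective SameType _≡_ (c i)) where

        private
          Stage : Set _
          Stage = ∃[ U ] M ≤K U × (∣ U ∣ ↔ Y)

          RealizedAt : Y × X → Stage → Set _
          RealizedAt (i , x) (U , _) =
            ∀ t → c i t ≡ x → Realizes (F i) U {Triple.N t} (Triple.b t)

          _◁_ : Stage → Stage → Set _
          s ◁ t = proj₁ s ≤K proj₁ t

          Y×X↣Y : (Y × X) ↣ Y
          Y×X↣Y = ↣-trans (↣-refl ×-↣ X↣Y) (×-absorb Y ℕ↣Y)

          w : WO (Y × X)
          w = zermelo (Y × X)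

          stage-union : (δ : WellOrder ℓ) → WellOrder.Index δ ↣ Y →
                        (g : WellOrder.Index δ → Stage) → Monotone δ _◁_ g →
                        Σ[ U ∈ Stage ] ∀ x → g x ◁ U
          stage-union δ δ↣Y g mono =
            case bounded δ {proj₁ ∘ g}
                  (record { model = λ i → ≤K-modelʳ (proj₁ (proj₂ (g i))) ; mono = mono })
                  ℕ↣Y δ↣Y (λ i → proj₂ (proj₂ (g i))) of λ where
              (U , _ , _ , size , upper) →
                (U , ≤K-trans (proj₁ (proj₂ (g (WellOrder.0# δ)))) (upper _) , size) , upper

          -- Triples with the same code have the same type by injectivity of `c`, so realizing one
          -- of them serves all. A code that no triple has leaves the stage unchanged.
          realize-code : ∀ p (s : Stage) → Σ[ t ∈ Stage ] RealizedAt p t × s ◁ t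
          realize-code (i , x) s@(U , M≤U , U↔Y) = case em of λ where
            (no n) → s , (λ t e → contradiction (t , e) n) , ≤K-refl (≤K-modelʳ M≤U)
            (yes (t , e)) →
              case realize LS↣Y U↔Y (≤K-trans (F≤M i) M≤U) (Triple.M≤N t) (Triple.b t) of λ where
                (U′ , U≤U′ , U′↔Y , u , same) →
                  (U′ , ≤K-trans M≤U U≤U′ , U′↔Y) ,
                  (λ t′ e′ → u , Same-trans amalgamation (Triple.M≤N t) same
                     (SameType⇒Same amalgamation (c-inj i (trans e (sym e′))))) ,
                  U≤U′

          s₀ : Stage
          s₀ = M , ≤K-refl m , M↔Y

          next-stage : ∀ p (g : Maybe (Seg w p) → Stage) →
                       Monotone (WO⇒WellOrder (segWO w p)) _◁_ g →
                       Σ[ t ∈ Stage ] RealizedAt p t × (∀ x → g x ◁ t)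
          next-stage p g mono =
            case stage-union (WO⇒WellOrder (segWO w p))
                   (↣-trans (Maybe-↣ (↣-trans sub-↣ Y×X↣Y)) (Maybe-absorb ℕ↣Y)) g mono of λ where
              (U , upper) → case realize-code p U of λ where
                (U′ , done , U≤U′) → U′ , done , λ x → ≤K-trans (upper x) U≤U′

        realize-all : ∃[ U ] M ≤K U × (∣ U ∣ ↔ Y) ×
                        (∀ i t → Realizes (F i) U {Triple.N t} (Triple.b t))
        realize-all = case transfiniteChain w _◁_ RealizedAt s₀ next-stage of λ where
          (g , mono , done) →
            case stage-union (WO⇒WellOrder w) (↣-trans (Maybe-↣ Y×X↣Y) (Maybe-absorb ℕ↣Y))
                   (maybe′ g s₀) mono of λ where
              ((U , M≤U , U↔Y) , upper) → U , M≤U , U↔Y , λ i t →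
                Realizes-mono amalgamation (≤K-trans (F≤M i) (proj₁ (proj₂ (g (i , c i t)))))
                  (upper (just (i , c i t))) (done (i , c i t) t refl)

      -- By regularity of Y, every submodel of size X lies in one of the Y many hulls of
      -- initial segments of M.
      saturate : Stable X → ∀ {M} → Model M → ∣ M ∣ ↔ Y →
                 ∃[ U ] M ≤K U × (∣ U ∣ ↔ Y) × SaturatedOver M U
      saturate stable {M} m M↔Y =
        case realize-all m M↔Y F≤M {proj₁ ∘ code} (λ i → proj₂ (proj₂ (code i))) of λ where
          (U , M≤U , U↔Y , realized) → U , M≤U , U↔Y , λ {A} {N} A≤M A↔X A≤N b →
            case regular ℕ↣X succ (↔⇒↣ A↔X) (Inverse.to M↔Y ∘ inclusion A≤M) of λ where
              (j , bound) →
                let A⊆F = contains A≤M j bound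
                    A≤F = coherence A (F j) M A⊆F A≤M (F≤M j)
                -- Amalgamating over `A` extends the type of `b` to a type over `F j`, and a
                -- realization of the extension also realizes its restriction to `A`.
                in case amalgamate amalgamation (≤K⇒KEmb A≤F) (≤K⇒KEmb A≤N) of λ where
                  (R , F≤R , q , q-A) →
                    case realized j (record { N = R ; M≤N = F≤R ; b = fn q b }) of λ where
                      (u , same) → u ,
                        Same-trans amalgamation (≤K-trans A≤F F≤R)
                          (Same-restrict {A} {F j} A⊆F same)
                          (Same-sym {A} (Same-KEmb {A} q (amalgam-fix A≤F A≤N q q-A) b))
        where
        part : ∀ i → ∃[ F ] F ≤K M × (∣ F ∣ ↔ X) ×
                       ((j : Seg order i) → el M (Inverse.from M↔Y (proj₁ j)) ∈ F)
        part i = hull m LS↣X (↣-trans X↣Y (↔⇒↣ (↔-sym M↔Y))) (segments i)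
                      (Inverse.from M↔Y ∘ proj₁)
        F : Y → Structure τ
        F i = proj₁ (part i)
        F≤M : ∀ i → F i ≤K M
        F≤M i = proj₁ (proj₂ (part i))
        code : ∀ i → Σ[ c ∈ (Triple (F i) → X) ]
                       Congruent SameType _≡_ c × Injective SameType _≡_ c
        code i = stable (F i) (≤K-modelˡ (F≤M i)) (proj₁ (proj₂ (proj₂ (part i))))
        contains : ∀ {A} (A≤M : A ≤K M) j →
                   (∀ a → WO._<_ order (Inverse.to M↔Y (inclusion A≤M a)) j) → A ⊆ F j
        contains A≤M j bound a =
          let c , e = proj₂ (proj₂ (proj₂ (part j))) (_ , squash (bound a))
          in c , trans e (trans (cong (el M) (Inverse.strictlyInverseʳ M↔Y _)) (inclusion-el A≤M a))

      -- Saturated models of successor cardinality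

      Saturated : Structure τ → Set _
      Saturated U = SaturatedOver U U

      saturated-exists : Stable X → ∀ {M} → Model M → ∣ M ∣ ↔ Y →
                         ∃[ U ] Model U × (∣ U ∣ ↔ Y) × Saturated U
      saturated-exists stable {M} m M↔Y =
        case transfiniteChain order _◁_ (λ _ _ → ⊤) (M , m , M↔Y) next-stage of λ where
          (g , mono , _) →
            let s = maybe′ g (M , m , M↔Y) in
            case bounded (WO⇒WellOrder order) {proj₁ ∘ s} (increasing (WO⇒WellOrder order) s mono)
                   ℕ↣Y (Maybe-absorb ℕ↣Y) (λ x → proj₂ (proj₂ (s x))) of λ where
              (U , isUnion , mU , U↔Y , upper) → U , mU , U↔Y ,
                λ {A} {N} A≤U A↔X A≤N b → case inside s mono isUnion upper A≤U A↔X of λ where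
                  -- Regularity for a constant function shows that `Y` has no last index: a stage
                  -- after `j` exists, and it realizes the types over `A`.
                  (j , A≤s) → case regular ℕ↣X succ ↣-refl (λ _ → j) of λ where
                    (j′ , j<j′) →
                      let j◁j′ = mono [ j<j′ (ℕ↣X ∙ 0) ] in
                      Realizes-mono amalgamation (≤K-trans A≤s (proj₁ j◁j′)) (upper (just j′))
                        (proj₂ j◁j′ A≤s A↔X A≤N b)
        where
        Stage : Set _
        Stage = ∃[ U ] Model U × (∣ U ∣ ↔ Y)

        -- Saturation is asked between any two stages, so no successor index has to be singled out.
        -- It passes to unions of earlier stages, as a submodel of an earlier stage is a submodel of
        -- the union.
        _◁_ : Stage → Stage → Set _
        s ◁ t = proj₁ s ≤K proj₁ t × SaturatedOver (proj₁ s) (proj₁ t)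

        increasing : (δ : WellOrder ℓ) (s : WellOrder.Index δ → Stage) → Monotone δ _◁_ s →
                     Increasing δ (proj₁ ∘ s)
        increasing δ s mono = record
          { model = λ x → proj₁ (proj₂ (s x)) ; mono = λ x<y → proj₁ (mono x<y) }

        next-stage : ∀ i (s : Maybe (Seg order i) → Stage) →
                     Monotone (WO⇒WellOrder (segWO order i)) _◁_ s →
                     Σ[ t ∈ Stage ] ⊤ × (∀ x → s x ◁ t)
        next-stage i s mono =
          case bounded (WO⇒WellOrder (segWO order i)) {proj₁ ∘ s} (increasing _ s mono) ℕ↣Y
                 (↣-trans (Maybe-↣ sub-↣) (Maybe-absorb ℕ↣Y)) (λ x → proj₂ (proj₂ (s x))) of λ where
            (U , _ , mU , U↔Y , upper) → case saturate stable mU U↔Y of λ where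
              (U′ , U≤U′ , U′↔Y , sat) → (U′ , ≤K-modelʳ U≤U′ , U′↔Y) , tt , λ x →
                ≤K-trans (upper x) U≤U′ ,
                λ {A} {N} A≤ A↔X A≤N b → sat (≤K-trans A≤ (upper x)) A↔X A≤N b

        inside : ∀ (s : Maybe Y → Stage) → Monotone (WO⇒WellOrder order) _◁_ s →
                 ∀ {U} → IsUnion (WO⇒WellOrder order) (proj₁ ∘ s) U → (∀ x → proj₁ (s x) ≤K U) →
                 ∀ {A} → A ≤K U → ∣ A ∣ ↔ X → ∃[ j ] A ≤K proj₁ (s (just j))
        inside s mono {U} isUnion upper {A} A≤U A↔X =
          case regular ℕ↣X succ (↔⇒↣ A↔X) (rank ∘ place) of λ where
            (j , bound) → j ,
              coherence A _ U (λ a → grow a (place-∈ a) (bound a)) A≤U (upper (just j))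
          where
          place : ∣ A ∣ → Maybe Y
          place a = proj₁ (IsUnion.covered isUnion (inclusion A≤U a))
          place-∈ : ∀ a → el A a ∈ proj₁ (s (place a))
          place-∈ a = let b , e = proj₂ (IsUnion.covered isUnion (inclusion A≤U a))
                      in b , trans e (inclusion-el A≤U a)
          rank : Maybe Y → Y
          -- The bottom stage precedes every index, so its rank may be any point of `Y`.
          rank = maybe′ id (X↣Y ∙ ℕ↣X ∙ 0)
          before : ∀ x {j} → WO._<_ order (rank x) j → _<₋_ (WO._<_ order) x (just j)
          before nothing  _   = ⊥₋<[ _ ]
          before (just i) i<j = [ i<j ]
          grow : ∀ a {x j} → el A a ∈ proj₁ (s x) → WO._<_ order (rank x) j →
                 el A a ∈ proj₁ (s (just j))
          grow a {x} (b , e) lt = let c , e′ = ≤K⇒⊆ (proj₁ (mono (before x lt))) b in c , trans e′ e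

      -- From saturation to homogeneity

      module _ {U : Structure τ} (mU : Model U) (U↔Y : ∣ U ∣ ↔ Y) (saturated : Saturated U)
               (N₀ : Structure τ) where

        -- A stage of moving N₀ into U: the part dom of the extension N of N₀ is moved.
        private
          record Stage : Set (lsuc ℓ ⊔ k) where
            field
              N dom  : Structure τ
              N₀≤N : N₀ ≤K N
              dom≤N  : dom ≤K N
              N↔X  : ∣ N ∣ ↔ X
              dom↔X  : ∣ dom ∣ ↔ X
              h    : KEmb dom U

          open Stage

          infix 4 _◁_
          record _◁_ (s t : Stage) : Set (lsuc ℓ ⊔ k) where
            field
              N≤   : N s ≤K N t
              dom≤   : dom s ≤K dom t
              same : ∀ a b → el (dom s) a ≡ el (dom t) b → label (h s) a ≡ label (h t) b

          open _◁_

          ◁-trans : ∀ {s t u} → s ◁ t → t ◁ u → s ◁ u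
          ◁-trans {s} {t} p q = record
            { N≤   = ≤K-trans (N≤ p) (N≤ q)
            ; dom≤   = ≤K-trans (dom≤ p) (dom≤ q)
            ; same = λ a c e → trans (same p a _ (sym (inclusion-el (dom≤ p) a)))
                                     (same q _ c (trans (inclusion-el (dom≤ p) a) e))
            }

        module _ (δ : WellOrder ℓ) (s : WellOrder.Index δ → Stage) (mono : Monotone δ _◁_ s)
                 {A∞ : Structure τ} (isUnion : IsUnion δ (dom ∘ s) A∞) where
          open WellOrder δ
          open IsStrictTotalOrder isStrictTotalOrder using (compare)
          open IsUnion isUnion

          private
            glue-fun : ∀ i j {a b} → el (dom (s i)) a ≡ el (dom (s j)) b →
                       label (h (s i)) a ≡ label (h (s j)) b
            glue-fun i j {a} {b} e with compare i j
            ... | tri< i<j _ _  = same (mono i<j) a b e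
            ... | tri> _ _ j<i  = sym (same (mono j<i) b a (sym e))
            ... | tri≈ _ refl _ = cong (label (h (s i))) (el-inj (dom (s i)) e)

            glue-inj< : ∀ {i j} → i < j → ∀ {a b} → label (h (s i)) a ≡ label (h (s j)) b →
                        el (dom (s i)) a ≡ el (dom (s j)) b
            glue-inj< {i} {j} i<j {a} e =
              let A≤′ = dom≤ (mono i<j)
                  a≡ = inclusion-el A≤′ a
              in trans (sym a≡) (cong (el (dom (s j))) (label-inj (h (s j))
                   (trans (sym (same (mono i<j) a _ (sym a≡))) e)))

            glue-inj : ∀ i j {a b} → label (h (s i)) a ≡ label (h (s j)) b →
                       el (dom (s i)) a ≡ el (dom (s j)) b
            glue-inj i j e with compare i j
            ... | tri< i<j _ _  = glue-inj< i<j e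
            ... | tri> _ _ j<i  = sym (glue-inj< j<i (sym e))
            ... | tri≈ _ refl _ = cong (el (dom (s i))) (label-inj (h (s i)) e)

            glue : ∣ A∞ ∣ → ∣ U ∣
            glue u = let i , a , _ = covered u in fn (h (s i)) a

            glue-label : ∀ i a u → el (dom (s i)) a ≡ el A∞ u → label (h (s i)) a ≡ el U (glue u)
            glue-label i a u e = let j , b , e′ = covered u in glue-fun i j (trans e (sym e′))

          -- The maps agree on common points. The image of the glued map is the union of the images,
          -- each a K-submodel of `U`, so smoothness makes it one too.
          glued : Σ[ g ∈ KEmb A∞ U ]
                    (∀ i a u → el (dom (s i)) a ≡ el A∞ u → label (h (s i)) a ≡ label g u)
          glued = record { fn = glue ; fn-inj = inj ; image≤ = image≤′ } , glue-label
            where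
            inj : Injective _≡_ _≡_ glue
            inj {u} {v} e =
              let i , a , a≡ = covered u
                  j , b , b≡ = covered v
              in el-inj A∞ (trans (sym a≡) (trans (glue-inj i j (cong (el U) e)) b≡))
            images : Index → Structure τ
            images i = image (h (s i))
            image∞ : Structure τ
            image∞ = relabel A∞ (el U ∘ glue) (inj ∘ el-inj U)
            image≤′ : image∞ ≤K U
            image≤′ = proj₂ (smoothness δ images
              (record
                { model = λ i → ≤K-modelˡ (image≤ (h (s i)))
                ; mono  = λ i<j → ≤K-relabel (dom≤ (mono i<j)) (same (mono i<j))
                })
              U mU (λ i → image≤ (h (s i))) image∞
              (record
                { upper = λ i → record
                    { incl        = incl (upper i)
                    ; incl-el     = λ a → sym (glue-label i a _ (sym (incl-el (upper i) a)))
                    ; isEmbedding = record { IsEmbedding (_⊑_.isEmbedding (upper i)) }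
                    }
                ; covered = λ u → let i , a , e = covered u in i , a , glue-label i a u e
                }))

        private
          stage-union : (δ : WellOrder ℓ) → WellOrder.Index δ ↣ X →
                        (s : WellOrder.Index δ → Stage) → Monotone δ _◁_ s →
                        Σ[ t ∈ Stage ] ∀ x → s x ◁ t
          stage-union δ δ↣X s mono =
            case bounded δ {N ∘ s}
                   (record { model = λ i → ≤K-modelʳ (dom≤N (s i)) ; mono = λ i<j → N≤ (mono i<j) })
                   ℕ↣X δ↣X (λ i → N↔X (s i)) of λ where
              (N∞ , _ , mN∞ , N∞↔X , N≤N∞) →
                case bounded δ {dom ∘ s} incA
                       ℕ↣X δ↣X (λ i → dom↔X (s i)) of λ where
                  (A∞ , isUnion , _ , A∞↔X , A≤A∞) → case glued δ s mono isUnion of λ where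
                    (g , g-label) →
                      record
                        { N = N∞ ; dom = A∞
                        ; N₀≤N = ≤K-trans (N₀≤N (s 0#)) (N≤N∞ 0#)
                        ; dom≤N = proj₂ (smoothness δ (dom ∘ s) incA N∞ mN∞
                                   (λ i → ≤K-trans (dom≤N (s i)) (N≤N∞ i)) A∞ isUnion)
                        ; N↔X = N∞↔X ; dom↔X = A∞↔X
                        ; h = g
                        } ,
                      λ i → record { N≤ = N≤N∞ i ; dom≤ = A≤A∞ i ; same = g-label i }
            where
            open WellOrder δ using (0#)
            incA : Increasing δ (dom ∘ s)
            incA = record
              { model = λ i → ≤K-modelˡ (dom≤N (s i)) ; mono = λ i<j → dom≤ (mono i<j) }

          -- The labels `d` turn `g` into the inclusion of `N s`, and carry `B` to a copy `B′`. As
          -- `f` and `g` agree on `dom s` through `h s`, the copy contains `dom s`; it contains `b`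
          -- because `u` is in `B`. The new map just undoes the renaming of `B`, and therefore
          -- extends `h s`.
          capture-along :
            ∀ (s : Stage) (b : ∣ N s ∣) {P B} (f : KEmb U P) (g : KEmb (N s) P) (B≤U : B ≤K U) →
            ∣ B ∣ ↔ X → (∀ a → el U (fn (h s) a) ∈ B) →
            (∀ a → fn f (fn (h s) a) ≡ fn g (inclusion (dom≤N s) a)) →
            ∀ {u} → el U u ∈ B → fn f u ≡ fn g b →
            Σ[ t ∈ Stage ] s ◁ t × el (N s) b ∈ dom t
          capture-along s b {P} {B} f g B≤U B↔X h∈B f∘h u∈B fu≡gb =
            case extend g (el (N s)) (el-inj (N s)) of λ where
              (d , d-inj , d-g , N≤P′) →
                let P′ = relabel P d d-inj
                    j  = into-relabel (f ⊙ ≤K⇒KEmb B≤U) d d-inj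
                    B′ = image j
                    meet : ∀ {v n} ((c , _) : el U v ∈ B) → fn f v ≡ fn g n → label j c ≡ el (N s) n
                    meet = λ (c , e) eq → trans (cong (d ∘ fn f) (inclusion-unique B≤U e))
                                            (trans (cong d eq) (d-g _))
                    h-label : ∀ a → label j (proj₁ (h∈B a)) ≡ el (dom s) a
                    h-label = λ a → trans (meet (h∈B a) (f∘h a)) (inclusion-el (dom≤N s) a)
                -- The amalgam may be too large; a hull of `N s` and `B′` has size X again and
                -- becomes the new source.
                in case hull (≤K-modelʳ N≤P′) LS↣X
                          (↣-trans (↔⇒↣ (↔-sym (N↔X s))) (incl-↣ (≤K⇒⊑ N≤P′)))
                          (↣-trans (↔⇒↣ (N↔X s) ⊎-↣ ↔⇒↣ B↔X) (⊎-absorb ℕ↣X))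
                          [ inclusion N≤P′ , fn j ]′ of λ where
                  (P″ , P″≤P′ , P″↔X , range) →
                    let N≤P″ = coherence (N s) P″ P′
                          (λ a → let c , e = range (inj₁ a) in c , trans e (inclusion-el N≤P′ a))
                          N≤P′ P″≤P′
                        B′≤P″ = coherence B′ P″ P′ (λ c → range (inj₂ c)) (image≤ j) P″≤P′
                        A≤B′ = coherence (dom s) B′ P″ (λ a → proj₁ (h∈B a) , h-label a)
                                 (≤K-trans (dom≤N s) N≤P″) B′≤P″
                    in record
                         { N = P″ ; dom = B′
                         ; N₀≤N = ≤K-trans (N₀≤N s) N≤P″ ; dom≤N = B′≤P″
                         ; N↔X = P″↔X ; dom↔X = B↔X
                         ; h = to-relabel (≤K⇒KEmb B≤U)
                         } ,
                       record
                         { N≤ = N≤P″ ; dom≤ = A≤B′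
                         ; same = λ a c e →
                             trans (cong (el U) (sym (inclusion-unique B≤U (proj₂ (h∈B a)))))
                               (cong (el U ∘ inclusion B≤U)
                                 (label-inj j (trans (h-label a) e)))
                         } ,
                       proj₁ u∈B , meet u∈B fu≡gb

          -- The type of b over dom, transported along h, is realized in U by some u; let B be
          -- a hull of h[dom] and u in U.  Inside a common extension P of B and N, suitably
          -- relabelled, B becomes an extension of dom containing b.
          capture : ∀ (s : Stage) (b : ∣ N s ∣) → Σ[ t ∈ Stage ] s ◁ t × el (N s) b ∈ dom t
          capture s b = case extend (≤K⇒KEmb (dom≤N s)) (label (h s)) (label-inj (h s)) of λ where
            (e , e-inj , e-A , A≤N′) → case saturated (image≤ (h s)) (dom↔X s) A≤N′ b of λ where
              (u , P , f , g , fix-f , fix-g , fu≡gb) →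
                case hull mU LS↣X (↣-trans X↣Y (↔⇒↣ (↔-sym U↔Y)))
                       (↣-trans (Maybe-↣ (↔⇒↣ (dom↔X s))) (Maybe-absorb ℕ↣X))
                       (maybe′ (fn (h s)) u) of λ where
                  (B , B≤U , B↔X , range) →
                    capture-along s b f (from-relabel g) B≤U B↔X (λ a → range (just a))
                      (λ a → el-inj P (trans (fix-f a (fn (h s) a) refl)
                        (sym (fix-g a (inclusion (dom≤N s) a) (sym (e-A a))))))
                      (range nothing) fu≡gb

        -- Only `N₀` is enumerated, so points added to the source need not be moved. Once `dom t`
        -- contains `N₀`, coherence inside `N t` makes `N₀` a K-submodel of it, and `h t` is
        -- restricted.
        saturated⇒homogeneous : ∀ {A₀} (A₀≤N₀ : A₀ ≤K N₀) → ∣ A₀ ∣ ↔ X → ∣ N₀ ∣ ↔ X →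
          (h₀ : KEmb A₀ U) → Σ[ f ∈ KEmb N₀ U ] ∀ a → label f (inclusion A₀≤N₀ a) ≡ label h₀ a
        saturated⇒homogeneous {A₀} A₀≤N₀ A₀↔X N₀↔X h₀ =
          case transfiniteChain w _◁_ (λ n t → el N₀ n ∈ dom t) s₀ next-stage of λ where
            (g , mono , captured) →
              case stage-union (WO⇒WellOrder w)
                     (↣-trans (Maybe-↣ (↔⇒↣ N₀↔X)) (Maybe-absorb ℕ↣X)) (maybe′ g s₀) mono of λ where
                (t , s◁t) →
                  let N₀≤dom = coherence N₀ (dom t) (N t)
                        (λ n → let c , e = captured n
                                   c′ , e′ = ≤K⇒⊆ (dom≤ (s◁t (just n))) c in c′ , trans e′ e)
                        (N₀≤N t) (dom≤N t)
                  in h t ⊙ ≤K⇒KEmb N₀≤dom , λ a → sym (same (s◁t nothing) a _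
                       (sym (trans (inclusion-el N₀≤dom _) (inclusion-el A₀≤N₀ a))))
          where
          w : WO ∣ N₀ ∣
          w = zermelo ∣ N₀ ∣
          s₀ : Stage
          s₀ = record
            { N = N₀ ; dom = A₀ ; N₀≤N = ≤K-refl (≤K-modelʳ A₀≤N₀) ; dom≤N = A₀≤N₀
            ; N↔X = N₀↔X ; dom↔X = A₀↔X ; h = h₀ }
          next-stage : ∀ n (s : Maybe (Seg w n) → Stage) →
                       Monotone (WO⇒WellOrder (segWO w n)) _◁_ s →
                       Σ[ t ∈ Stage ] el N₀ n ∈ dom t × (∀ x → s x ◁ t)
          next-stage n s mono =
            case stage-union (WO⇒WellOrder (segWO w n))
                   (↣-trans (Maybe-↣ (↣-trans sub-↣ (↔⇒↣ N₀↔X))) (Maybe-absorb ℕ↣X))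
                   s mono of λ where
              (t , s◁t) → case capture t (inclusion (N₀≤N t) n) of λ where
                (t′ , t◁t′ , c , e) →
                  t′ , (c , trans e (inclusion-el (N₀≤N t) n)) , λ x → ◁-trans (s◁t x) t◁t′

      -- Transfer to arbitrary models

      homogeneous : Stable X → Categorical Y → ∀ {M} → Model M → ∣ M ∣ ↔ Y →
        ∀ {A N} (A≤N : A ≤K N) (A≤M : A ≤K M) → ∣ A ∣ ↔ X → ∣ N ∣ ↔ X →
        Σ[ f ∈ KEmb N M ] ∀ a → label f (inclusion A≤N a) ≡ el A a
      homogeneous stable (_ , unique) {M} m M↔Y {A} {N} A≤N A≤M A↔X N↔X =
        case saturated-exists stable m M↔Y of λ where
          (U , mU , U↔Y , sat) →
            let φ = unique M U m mU M↔Y U↔Y in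
            case saturated⇒homogeneous mU U↔Y sat N A≤N A↔X N↔X
                   (≅⇒KEmb m φ ⊙ ≤K⇒KEmb A≤M) of λ where
              (f , f-A) → ≅⇒KEmb mU (≅-sym φ) ⊙ f , λ a →
                trans (cong (el M ∘ ≅-from φ) (el-inj U (f-A a)))
                  (trans (cong (el M) (≅-from-to φ _)) (inclusion-el A≤M a))

    modelHomogeneous :
      (∀ M → Model M → ¬ (∣ M ∣ ≺ LS)) → (∀ Λ → Dom Λ → Categorical Λ × Stable Λ) →
      ∀ M → Model M → ModelHomogeneous M
    modelHomogeneous big cat-stable M m M₀ N₀ M₀≤N₀ M₀≤M (X↣M , M↣̸X) =
      case successor X ∣ M ∣ M↣̸X of λ where
        (Y , Y↣M , succ) → case enlarge of λ where
          (M₁ , N₁ , M₁≤M , M₁≤N₁ , M₁↔X , N₁↔X , q , q-fix) →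
            case hull m (↣-trans LS↣X (X↣ succ)) Y↣M (↣-trans (↔⇒↣ M₁↔X) (X↣ succ))
                   (inclusion M₁≤M) of λ where
              (M′ , M′≤M , M′↔Y , range) →
                let M₁≤M′ = coherence M₁ M′ M
                      (λ a → proj₁ (range a) , trans (proj₂ (range a)) (inclusion-el M₁≤M a))
                      M₁≤M M′≤M
                    m′ = ≤K-modelˡ M′≤M
                -- X is in the domain by `N₀` and Y by `M′`, which is what gives stability in X and
                -- categoricity in Y.
                in case homogeneous LS↣X succ
                          (proj₂ (cat-stable X (N₀ , ≤K-modelʳ M₀≤N₀ , ↔-refl)))
                          (proj₁ (cat-stable Y (M′ , m′ , M′↔Y))) m′ M′↔Y
                          M₁≤N₁ M₁≤M′ M₁↔X N₁↔X of λ where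
                  (f , f-fix) →
                    toKEmbedding (≤K⇒KEmb M′≤M ⊙ (f ⊙ q)) , λ a x e →
                      trans (inclusion-el M′≤M _)
                        (let b , b≡ , qx≡b = q-fix a x e in
                         trans (cong (label f) qx≡b) (trans (f-fix b) b≡))
      where
      X : Set ℓ
      X = ∣ N₀ ∣
      LS↣X : LS ↣ X
      LS↣X = case ↣-total LS X of λ where
        (inj₁ i) → i
        (inj₂ i) → case em of λ where
          (yes j) → j
          (no n)  → contradiction (i , n) (big N₀ (≤K-modelʳ M₀≤N₀))
      X↣ : ∀ {Y} → Successor X Y → X ↣ Y
      X↣ = below-successor (↣-trans ℕ↣LS LS↣X)

      -- Brings the base up to size X: `M₁` is a hull of `M₀` in `M`, and `N₁` is cut from an
      -- amalgam of `M₁` and `N₀` over `M₀`. Embedding `N₁` over `M₁` then embeds `N₀` over `M₀`.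
      enlarge : ∃[ M₁ ] ∃[ N₁ ] M₁ ≤K M × Σ[ M₁≤N₁ ∈ M₁ ≤K N₁ ] (∣ M₁ ∣ ↔ X) × (∣ N₁ ∣ ↔ X) ×
                Σ[ q ∈ KEmb N₀ N₁ ] (∀ a x → el M₀ a ≡ el N₀ x →
                  ∃[ b ] el M₁ b ≡ el M₀ a × fn q x ≡ inclusion M₁≤N₁ b)
      enlarge = case hull m LS↣X X↣M (incl-↣ (≤K⇒⊑ M₀≤N₀)) (inclusion M₀≤M) of λ where
        (M₁ , M₁≤M , M₁↔X , range) →
          let M₀≤M₁ = coherence M₀ M₁ M
                (λ a → proj₁ (range a) , trans (proj₂ (range a)) (inclusion-el M₀≤M a)) M₀≤M M₁≤M
          in case amalgamate amalgamation (≤K⇒KEmb M₀≤M₁) (≤K⇒KEmb M₀≤N₀) of λ where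
            (R , M₁≤R , q , q-M₀) →
              case hull (≤K-modelʳ M₁≤R) LS↣X
                     (↣-trans (↔⇒↣ (↔-sym M₁↔X)) (incl-↣ (≤K⇒⊑ M₁≤R)))
                     (↣-trans (↔⇒↣ M₁↔X ⊎-↣ ↣-refl) (⊎-absorb (↣-trans ℕ↣LS LS↣X)))
                     [ inclusion M₁≤R , fn q ]′ of λ where
                (N₁ , N₁≤R , N₁↔X , range′) →
                  let M₁≤N₁ = coherence M₁ N₁ R
                        (λ a → let c , e = range′ (inj₁ a) in c , trans e (inclusion-el M₁≤R a))
                        M₁≤R N₁≤R
                      q≤N₁ = coherence (image q) N₁ R (λ x → range′ (inj₂ x)) (image≤ q) N₁≤R
                  in M₁ , N₁ , M₁≤M , M₁≤N₁ , M₁↔X , N₁↔X , from-relabel (≤K⇒KEmb q≤N₁) ,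
                     λ a x e → inclusion M₀≤M₁ a , inclusion-el M₀≤M₁ a ,
                       el-inj N₁ (trans (inclusion-el q≤N₁ x)
                         (trans (amalgam-fix M₀≤M₁ M₀≤N₀ q q-M₀ a x e)
                           (sym (trans (inclusion-el M₁≤N₁ _) (inclusion-el M₀≤M₁ a)))))

theorem3p4 : (∀ {a} → ExcludedMiddle a) → (∀ {a b} → Extensionality a b) →
    ∀ {ℓ k} {τ : Vocabulary ℓ} (K : FragmentedAEC τ k) →
    let open FragmentedAEC K in
    Amalgamation →
    (∀ M → Model M → ¬ (∣ M ∣ ≺ LS)) →
    (∀ Λ → Dom Λ → Categorical Λ × Stable Λ) →
    ∀ M → Model M → LS ≺ ∣ M ∣ → ModelHomogeneous M
theorem3p4 em ext K amalgamation big cat-stable M m _ =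
  Fragment.modelHomogeneous em ext K amalgamation big cat-stable M m
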